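{- Every planar graph of girth $5$ has inversion diameter at most $7$, and every planar graph of girth $6$ has inversion diameter at most $5$.
   Context: Graphs are finite and simple. For an oriented graph $\overrightarrow{G}$ and $X\subseteq V(\overrightarrow{G})$, the inversion of $X$ reverses every arc having both endpoints in $X$ (and no other arc). For a (labeled) graph $G$, the inversion distance between two orientations of $G$ is the minimum number of inversions transforming one into the other (equality as labeled oriented graphs), and the inversion diameter of $G$ is the maximum inversion distance over all pairs of orientations of $G$. The girth of a graph is the length of a shortest cycle. -}

module Defs where

open import Data.Bool using (Bool; true; false; not; _∧_; if_then_else_; T)
open import Data.Fin using (Fin; toℕ)
open import Data.Fin.Subset using (Subset)
open import Data.Nat using (ℕ; suc; _+_; _*_; _≤_)
open import Data.Product using (_×_; ∃-syntax)
open import Data.Vec using (Vec; []; _∷_; lookup)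
open import Function using (_∘_; _↔_; _⇔_; Bijection; Inverse)
open import Function.Definitions using (Injective)
open import Level using (0ℓ)
open import Relation.Binary using (Rel)
open import Relation.Binary.Construct.Closure.Equivalence as Eq using (EqClosure)
open import Relation.Binary.Construct.Union using (_∪_)
open import Relation.Binary.PropositionalEquality
  using (_≡_; subst; setoid)

record Graph (n : ℕ) : Set where
  field
    adj       : Fin n → Fin n → Bool
    symmetric : ∀ u v → adj u v ≡ adj v u
    loopless  : ∀ v → adj v v ≡ false

  Adj : Rel (Fin n) 0ℓ
  Adj u v = T (adj u v)

open Graph public using (Adj)

record Cycle {n} (G : Graph n) (k : ℕ) : Set where
  field
    3≤length : 3 ≤ k
    vertex   : Fin k → Fin n
    distinct : Injective _≡_ _≡_ vertex
    steps    : ∀ i j → toℕ j ≡ suc (toℕ i) → Adj G (vertex i) (vertex j)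
    closing  : ∀ i j → suc (toℕ i) ≡ k → toℕ j ≡ 0 → Adj G (vertex i) (vertex j)

HasGirth : ∀ {n} → Graph n → ℕ → Set
HasGirth G g = Cycle G g × (∀ k → Cycle G k → g ≤ k)

-- A drawing on an oriented surface is encoded, up to homeomorphism, by
-- its rotation system: the cyclic order of the edge-ends around each
-- vertex.  Planar means that some rotation system has genus 0.

record Dart {n} (G : Graph n) : Set where
  constructor dart
  field
    src tgt : Fin n
    edge    : Adj G src tgt

open Dart public using (src; tgt)

rev : ∀ {n} {G : Graph n} → Dart G → Dart G
rev {G = G} (dart u v uv) = dart v u (subst T (Graph.symmetric G u v) uv)

Step : ∀ {A : Set} → (A → A) → Rel A 0ℓ
Step f x y = f x ≡ y

-- The equivalence relation generated by R has exactly k classes.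
HasClasses : ∀ {A : Set} → Rel A 0ℓ → ℕ → Set
HasClasses R k = Bijection (Eq.setoid R) (setoid (Fin k))

-- The orbits of rot are the sets of darts leaving a common vertex, so rot
-- permutes the darts at each vertex in a single cycle.
record RotationSystem {n} (G : Graph n) : Set where
  field
    rot    : Dart G ↔ Dart G
    orbits : ∀ d e → EqClosure (Step (Inverse.to rot)) d e ⇔ (src d ≡ src e)

  next : Dart G → Dart G
  next = Inverse.to rot

-- Euler's formula  v − e + f = 2c − 2g  for the closed surface, with one
-- component per component of the graph, obtained by gluing a disc along
-- each orbit of next ∘ rev; g is the total genus.  Disjoint components do
-- not share a face here, which is why 2c replaces the c + 1 of a drawing
-- in one sphere.  Everything is counted on darts, so isolated vertices,
-- which do not affect planarity, contribute to neither v nor c.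
record HasGenus {n} {G : Graph n} (S : RotationSystem G) (g : ℕ) : Set where
  open RotationSystem S
  field
    {v e f c}  : ℕ
    vertices   : HasClasses (Step next) v
    edges      : HasClasses (Step (rev {G = G})) e
    faces      : HasClasses (Step (next ∘ rev)) f
    components : HasClasses (Step next ∪ Step rev) c
    euler      : v + f + 2 * g ≡ e + 2 * c

Planar : ∀ {n} → Graph n → Set
Planar G = ∃[ S ] HasGenus {G = G} S 0

record Orientation {n} (G : Graph n) : Set where
  field
    arc      : Fin n → Fin n → Bool
    arc⇒adj  : ∀ u v → T (arc u v) → Adj G u v
    oriented : ∀ u v → Adj G u v → arc v u ≡ not (arc u v)

open Orientation public using (arc)

-- Equality as labelled oriented graphs.
_≈_ : ∀ {n} {G : Graph n} → Rel (Orientation G) 0ℓ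
O ≈ O′ = ∀ u v → arc O u v ≡ arc O′ u v

invert : ∀ {n} {G : Graph n} → Subset n → Orientation G → Orientation G
invert {n} {G} X O = record
  { arc      = arc′
  ; arc⇒adj  = arc′⇒adj
  ; oriented = oriented′
  }
  where
  open Graph G using (symmetric)
  open Orientation O using (arc⇒adj; oriented)

  flip : Fin n → Fin n → Bool
  flip u v = lookup X u ∧ lookup X v

  arc′ : Fin n → Fin n → Bool
  arc′ u v = if flip u v then arc O v u else arc O u v

  adj-sym : ∀ u v → Adj G u v → Adj G v u
  adj-sym u v = subst T (symmetric u v)

  arc′⇒adj : ∀ u v → T (arc′ u v) → Adj G u v
  arc′⇒adj u v a with flip u v
  ... | true  = adj-sym v u (arc⇒adj v u a)
  ... | false = arc⇒adj u v a

  oriented′ : ∀ u v → Adj G u v → arc′ v u ≡ not (arc′ u v)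
  oriented′ u v uv with lookup X u | lookup X v
  ... | true  | true  = oriented v u (adj-sym u v uv)
  ... | true  | false = oriented u v uv
  ... | false | true  = oriented u v uv
  ... | false | false = oriented u v uv

invertAll : ∀ {n k} {G : Graph n} → Vec (Subset n) k → Orientation G → Orientation G
invertAll []       O = O
invertAll (X ∷ Xs) O = invertAll Xs (invert X O)

TransformableIn : ∀ {n} {G : Graph n} → ℕ → Rel (Orientation G) 0ℓ
TransformableIn {n} k O O′ = ∃[ Xs ] invertAll {n} {k} Xs O ≈ O′

IsInversionDistance : ∀ {n} {G : Graph n} → Orientation G → Orientation G → ℕ → Set
IsInversionDistance O O′ d =
  TransformableIn d O O′ × (∀ k → TransformableIn k O O′ → d ≤ k)

IsInversionDiameter : ∀ {n} → Graph n → ℕ → Set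
IsInversionDiameter G D =
  (∃[ O ] ∃[ O′ ] IsInversionDistance {G = G} O O′ D) ×
  (∀ O O′ d → IsInversionDistance {G = G} O O′ d → d ≤ D)

{-# OPTIONS --safe #-}

-- Encoding a sequence of t inversions by vectors x_v ∈ 𝔽₂ᵗ, one per vertex, the arc between u and v is
-- reversed x_u · x_v times.  So it suffices to find, for every symmetric 0/1-labelling π of the edges,
-- vectors with x_u · x_v = π(uv); we ask in addition that none of them is zero.  A vertex can be added to
-- a partial solution as soon as the vectors of its neighbours are independent, and a vertex of
-- degree r can be given at least 2^(t − r) different vectors.  This makes three configurations reducible:
-- a vertex of degree ≤ 1; a vertex with k ≥ 1 neighbours of degree 2 and r other ones where
-- 1 + k < 2^(t − r); and, if t ≥ 7, a vertex of degree 3 with two neighbours of degree ≤ 5.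
-- Discharging shows that a graph without them has average degree ≥ 3 if t = 5 and ≥ 10/3 if t = 7.
--
-- On the other side, all induced subgraphs of a planar graph of girth 6 (5) have average degree
-- below 3 (10/3).  Instead of deleting edges from a rotation system, we merge vertices along the edges in
-- one order and faces along them in the opposite order.  An edge never merges on both sides, since a
-- cut of the graph and a cut of its dual share an even number of edges; by Euler's formula every edge
-- therefore merges on exactly one side.  This is Euler's inequality for the subgraph, whose faces are
-- the regions obtained by merging the faces of G along all other edges; a walk along the boundary of
-- a region does not backtrack, so it visits as many vertices as the girth before repeating one.
module Submission where

open import Defs
open import Algebra.Bundles using (CommutativeRing)
open import Data.Bool using (Bool; true; false; not; _∧_; _xor_; if_then_else_; T)
import Data.Bool.Properties as Boolₚ
open import Data.Empty using (⊥; ⊥-elim)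
open import Data.Fin as Fin using (Fin; zero; suc; toℕ; combine; punchIn; punchOut; splitAt; _↑ˡ_; _↑ʳ_)
import Data.Fin.Properties as Finₚ
open import Data.Fin.Subset using (Subset)
open import Data.Fin.Subset.Properties using (anySubset?)
open import Data.List as List
  using (List; []; _∷_; length; map; filter; allFin; tabulate; concat; reverse; _++_; _ʳ++_)
import Data.List.Membership.DecPropositional as DecMembership
open import Data.List.Membership.Propositional using (_∈_; _∉_)
import Data.List.Membership.Propositional.Properties as ∈ₚ
import Data.List.Membership.Setoid.Properties as ∈ₛ
import Data.List.Properties as Listₚ
open import Data.List.Relation.Unary.All as All using (All; []; _∷_)
import Data.List.Relation.Unary.All.Properties as Allₚ
open import Data.List.Relation.Unary.AllPairs using ([]; _∷_)
import Data.List.Relation.Unary.AllPairs.Properties as AllPairsₚ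
open import Data.List.Relation.Unary.Any as Any using (here; there)
import Data.List.Relation.Unary.Any.Properties as Anyₚ
open import Data.List.Relation.Unary.Unique.Propositional using (Unique)
import Data.List.Relation.Unary.Unique.Propositional.Properties as Uniqueₚ
open import Data.Nat using (ℕ; zero; suc; _+_; _*_; _∸_; _^_; _≤_; _<_; _≤?_; z≤n; s≤s)
import Data.Nat.Properties as ℕₚ
open import Data.Nat.Solver using (module +-*-Solver)
open import Data.Product using (Σ; _×_; _,_; proj₁; proj₂; ∃; ∃-syntax; uncurry)
open import Data.Sum using (_⊎_; inj₁; inj₂; fromInj₁; [_,_]′)
open import Data.Vec as Vec using (Vec; []; _∷_)
import Data.Vec.Properties as Vecₚ
open import Function using (_∘_; id; _↔_; Inverse; Bijection; Equivalence; Injective; mk↔ₛ′)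
open import Function.Construct.Composition using (_↔-∘_)
open import Function.Construct.Symmetry using (↔-sym)
open import Relation.Binary using (IsEquivalence; tri<; tri≈; tri>)
open import Relation.Binary.Construct.Closure.Equivalence as Eq using (EqClosure)
open import Relation.Binary.Construct.Closure.ReflexiveTransitive using (ε; _◅_)
open import Relation.Binary.Construct.Closure.Symmetric using (fwd; bwd)
open import Relation.Binary.PropositionalEquality
open import Relation.Nullary using (Dec; yes; no; ¬_; contradiction; does)
open import Relation.Nullary.Decidable
  using (¬?; _×-dec_; _⊎-dec_; _→-dec_; map′; T?; dec-true; dec-false; decidable-stable)

-- Counting

open import Algebra.Properties.CommutativeMonoid.Sum ℕₚ.+-0-commutativeMonoid
  using () renaming (sum to ∑; ∑-distrib-+ to ∑-+; ∑-comm to ∑-swap; sum-cong-≗ to ∑-cong)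

private
  variable
    A : Set
    n m t : ℕ

lookup-injective : ∀ {xs : List A} → Unique xs → Injective _≡_ _≡_ (List.lookup xs)
lookup-injective {xs = x ∷ xs} (_ ∷ u) {zero}  {zero}  eq = refl
lookup-injective {xs = x ∷ xs} (x∉ ∷ u) {zero}  {suc j} eq = ⊥-elim (All.lookup x∉ (∈ₚ.∈-lookup j) eq)
lookup-injective {xs = x ∷ xs} (x∉ ∷ u) {suc i} {zero}  eq = ⊥-elim (All.lookup x∉ (∈ₚ.∈-lookup i) (sym eq))
lookup-injective {xs = x ∷ xs} (_ ∷ u) {suc i} {suc j} eq = cong suc (lookup-injective u eq)

injective∈⇒≤length : ∀ {ys : List A} (f : Fin m → A) → Injective _≡_ _≡_ f →
                     (∀ i → f i ∈ ys) → m ≤ length ys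
injective∈⇒≤length f inj f∈ = Finₚ.injective⇒≤ {f = Any.index ∘ f∈}
  λ {i} {j} eq → inj (∈ₛ.index-injective (setoid _) (f∈ i) (f∈ j) eq)

unique⊆⇒length≤ : ∀ {xs ys : List A} → Unique xs → (∀ {x} → x ∈ xs → x ∈ ys) → length xs ≤ length ys
unique⊆⇒length≤ {xs = xs} u xs⊆ys =
  injective∈⇒≤length (List.lookup xs) (lookup-injective u) (λ i → xs⊆ys (∈ₚ.∈-lookup i))

⟦_⟧ : Bool → ℕ
⟦ true ⟧  = 1
⟦ false ⟧ = 0

count : (Fin n → Bool) → ℕ
count P = ∑ (⟦_⟧ ∘ P)

members : (Fin n → Bool) → List (Fin n)
members {n} P = filter (λ i → P i Boolₚ.≟ true) (allFin n)

∑-mono : ∀ {f g : Fin n → ℕ} → (∀ i → f i ≤ g i) → ∑ f ≤ ∑ g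
∑-mono {n = zero}  f≤g = z≤n
∑-mono {n = suc n} f≤g = ℕₚ.+-mono-≤ (f≤g zero) (∑-mono (f≤g ∘ suc))

∑-*ˡ : ∀ c (f : Fin n → ℕ) → ∑ (λ i → c * f i) ≡ c * ∑ f
∑-*ˡ {n = zero}  c f = sym (ℕₚ.*-zeroʳ c)
∑-*ˡ {n = suc n} c f = trans (cong (c * f zero +_) (∑-*ˡ c (f ∘ suc))) (sym (ℕₚ.*-distribˡ-+ c (f zero) _))

∑-zero : ∀ {f : Fin n → ℕ} → (∀ i → f i ≡ 0) → ∑ f ≡ 0
∑-zero {n = zero}  f≡0 = refl
∑-zero {n = suc n} f≡0 = cong₂ _+_ (f≡0 zero) (∑-zero (f≡0 ∘ suc))

∑-single : ∀ (f : Fin n → ℕ) i → f i ≤ ∑ f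
∑-single f zero    = ℕₚ.m≤m+n _ _
∑-single f (suc i) = ℕₚ.≤-trans (∑-single (f ∘ suc) i) (ℕₚ.m≤n+m _ _)

length-filter-tabulate : ∀ (f : Fin n → A) (P : A → Bool) →
  length (filter (λ a → P a Boolₚ.≟ true) (tabulate f)) ≡ count (P ∘ f)
length-filter-tabulate {n = zero}  f P = refl
length-filter-tabulate {n = suc n} f P with P (f zero)
... | true  = cong suc (length-filter-tabulate (f ∘ suc) P)
... | false = length-filter-tabulate (f ∘ suc) P

length-members : (P : Fin n → Bool) → length (members P) ≡ count P
length-members P = length-filter-tabulate id P

members-unique : (P : Fin n → Bool) → Unique (members P)
members-unique {n} P = Uniqueₚ.filter⁺ _ (Uniqueₚ.allFin⁺ n)

∈-members⁺ : ∀ (P : Fin n → Bool) {i} → P i ≡ true → i ∈ members P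
∈-members⁺ P Pi = ∈ₚ.∈-filter⁺ _ (∈ₚ.∈-allFin _) Pi

∈-members⁻ : ∀ (P : Fin n → Bool) {i} → i ∈ members P → P i ≡ true
∈-members⁻ {n} P i∈ = proj₂ (∈ₚ.∈-filter⁻ _ {xs = allFin n} i∈)

count-mono : ∀ {P Q : Fin n → Bool} → (∀ i → P i ≡ true → Q i ≡ true) → count P ≤ count Q
count-mono {P = P} {Q} P⊆Q = ∑-mono pointwise
  where
  pointwise : ∀ i → ⟦ P i ⟧ ≤ ⟦ Q i ⟧
  pointwise i with P i in eq
  ... | false = z≤n
  ... | true  rewrite P⊆Q i eq = s≤s z≤n

count-split : ∀ (P Q : Fin n → Bool) →
  count P ≡ count (λ i → P i ∧ not (Q i)) + count (λ i → P i ∧ Q i)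
count-split P Q = trans (∑-cong pointwise) (∑-+ (λ i → ⟦ P i ∧ not (Q i) ⟧) (λ i → ⟦ P i ∧ Q i ⟧))
  where
  pointwise : ∀ i → ⟦ P i ⟧ ≡ ⟦ P i ∧ not (Q i) ⟧ + ⟦ P i ∧ Q i ⟧
  pointwise i with P i | Q i
  ... | true  | true  = refl
  ... | true  | false = refl
  ... | false | true  = refl
  ... | false | false = refl

∈⇒0<count : ∀ (P : Fin n → Bool) {i} → P i ≡ true → 0 < count P
∈⇒0<count P {i} Pi = ℕₚ.≤-trans (ℕₚ.≤-reflexive (cong ⟦_⟧ (sym Pi))) (∑-single (⟦_⟧ ∘ P) i)

∧-trueˡ : ∀ {a b} → a ∧ b ≡ true → a ≡ true
∧-trueˡ {true} _ = refl

∧-trueʳ : ∀ {a b} → a ∧ b ≡ true → b ≡ true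
∧-trueʳ {true} p = p

∧-true : ∀ {a b} → a ≡ true → b ≡ true → a ∧ b ≡ true
∧-true refl refl = refl

T⇒true : ∀ {b} → T b → b ≡ true
T⇒true {true} _ = refl

true⇒T : ∀ {b} → b ≡ true → T b
true⇒T refl = _

-- Linear algebra over 𝔽₂

𝔽₂^ : ℕ → Set
𝔽₂^ = Vec Bool

infixl 6 _⊕_

_⊕_ : 𝔽₂^ t → 𝔽₂^ t → 𝔽₂^ t
_⊕_ = Vec.zipWith _xor_

𝟎 : 𝔽₂^ t
𝟎 = Vec.replicate _ false

infixl 7 _·_

_·_ : 𝔽₂^ t → 𝔽₂^ t → Bool
[]      · []      = false
(a ∷ x) · (b ∷ y) = (a ∧ b) xor (x · y)

_≟ᵥ_ : (x y : 𝔽₂^ t) → Dec (x ≡ y)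
_≟ᵥ_ = Vecₚ.≡-dec Boolₚ._≟_

xor-interchange : ∀ a b c d → (a xor b) xor (c xor d) ≡ (a xor c) xor (b xor d)
xor-interchange a b c d = trans (Boolₚ.xor-assoc a b (c xor d))
  (trans (cong (a xor_) (trans (sym (Boolₚ.xor-assoc b c d))
    (trans (cong (_xor d) (Boolₚ.xor-comm b c)) (Boolₚ.xor-assoc c b d))))
  (sym (Boolₚ.xor-assoc a c (b xor d))))

·-comm : (x y : 𝔽₂^ t) → x · y ≡ y · x
·-comm []      []      = refl
·-comm (a ∷ x) (b ∷ y) = cong₂ _xor_ (Boolₚ.∧-comm a b) (·-comm x y)

·-⊕ʳ : (x y z : 𝔽₂^ t) → x · (y ⊕ z) ≡ (x · y) xor (x · z)
·-⊕ʳ []      []      []      = refl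
·-⊕ʳ (a ∷ x) (b ∷ y) (c ∷ z) = trans
  (cong₂ _xor_ (Boolₚ.∧-distribˡ-xor a b c) (·-⊕ʳ x y z))
  (xor-interchange (a ∧ b) (a ∧ c) (x · y) (x · z))

·-⊕ˡ : (x y z : 𝔽₂^ t) → (x ⊕ y) · z ≡ (x · z) xor (y · z)
·-⊕ˡ x y z = trans (·-comm (x ⊕ y) z) (trans (·-⊕ʳ z x y) (cong₂ _xor_ (·-comm z x) (·-comm z y)))

⊕-identityˡ : (x : 𝔽₂^ t) → 𝟎 ⊕ x ≡ x
⊕-identityˡ []      = refl
⊕-identityˡ (a ∷ x) = cong (a ∷_) (⊕-identityˡ x)

⊕-cancelˡ : (x y z : 𝔽₂^ t) → x ⊕ y ≡ x ⊕ z → y ≡ z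
⊕-cancelˡ []      []      []      _  = refl
⊕-cancelˡ (a ∷ x) (b ∷ y) (c ∷ z) eq =
  cong₂ _∷_ (xor-cancelˡ a (proj₁ (Vecₚ.∷-injective eq))) (⊕-cancelˡ x y z (proj₂ (Vecₚ.∷-injective eq)))
  where
  xor-cancelˡ : ∀ a {b c} → a xor b ≡ a xor c → b ≡ c
  xor-cancelˡ true  = Boolₚ.not-injective
  xor-cancelˡ false = id

⊕-self : (x : 𝔽₂^ t) → x ⊕ x ≡ 𝟎
⊕-self []      = refl
⊕-self (a ∷ x) = cong₂ _∷_ (Boolₚ.xor-same a) (⊕-self x)

⊕-assoc : (x y z : 𝔽₂^ t) → (x ⊕ y) ⊕ z ≡ x ⊕ (y ⊕ z)
⊕-assoc = Vecₚ.zipWith-assoc Boolₚ.xor-assoc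

⊕≡𝟎⇒≡ : (x y : 𝔽₂^ t) → x ⊕ y ≡ 𝟎 → y ≡ x
⊕≡𝟎⇒≡ x y eq = ⊕-cancelˡ x y x (trans eq (sym (⊕-self x)))

·-zeroʳ : (x : 𝔽₂^ t) → x · 𝟎 ≡ false
·-zeroʳ []      = refl
·-zeroʳ (a ∷ x) = cong₂ _xor_ (Boolₚ.∧-zeroʳ a) (·-zeroʳ x)

Additive : (𝔽₂^ m → 𝔽₂^ t) → Set
Additive M = ∀ x y → M (x ⊕ y) ≡ M x ⊕ M y

-- A subspace of dimension `m` inside `P` is given by an injective linear parametrisation: its size
-- `2 ^ m` is then immediate, and a subspace of a subspace is a composite.
record Embedding (m t : ℕ) (P : 𝔽₂^ t → Set) : Set where
  field
    embed     : 𝔽₂^ m → 𝔽₂^ t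
    additive  : Additive embed
    injective : Injective _≡_ _≡_ embed
    property  : ∀ y → P (embed y)

open Embedding

-- If `ℓ` is 1 on the first basis vector, the first coordinate is solved for in terms of the others.
-- If it is 0 there, that coordinate is free and the recursion treats the others.
kernel : (ℓ : 𝔽₂^ (suc m) → Bool) → (∀ x y → ℓ (x ⊕ y) ≡ ℓ x xor ℓ y) →
         Embedding m (suc m) (λ x → ℓ x ≡ false)
kernel {m} ℓ ℓ-⊕ with ℓ (true ∷ 𝟎) in eq
... | true = record
  { embed     = λ y → ℓ (false ∷ y) ∷ y
  ; additive  = λ x y → cong (_∷ (x ⊕ y)) (ℓ-⊕ (false ∷ x) (false ∷ y))
  ; injective = Vecₚ.∷-injectiveʳ
  ; property  = vanishes
  }
  where
  vanishes : ∀ y → ℓ (ℓ (false ∷ y) ∷ y) ≡ false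
  vanishes y with ℓ (false ∷ y) in eq′
  ... | false = eq′
  ... | true  = trans (cong (ℓ ∘ (true ∷_)) (sym (⊕-identityˡ y)))
                      (trans (ℓ-⊕ (true ∷ 𝟎) (false ∷ y)) (cong₂ _xor_ eq eq′))
kernel {zero} ℓ ℓ-⊕ | false = record
  { embed     = false ∷_
  ; additive  = λ _ _ → refl
  ; injective = Vecₚ.∷-injectiveʳ
  ; property  = λ { [] → ℓ𝟎 }
  }
  where
  -- The zero vector is a sum `x ⊕ x`, on which an additive map vanishes.
  ℓ𝟎 : ℓ (false ∷ []) ≡ false
  ℓ𝟎 = trans (ℓ-⊕ (true ∷ []) (true ∷ [])) (Boolₚ.xor-same (ℓ (true ∷ [])))
kernel {suc m} ℓ ℓ-⊕ | false = record
  { embed     = λ { (b ∷ y) → b ∷ embed K y }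
  ; additive  = λ { (b ∷ x) (c ∷ y) → cong (_ ∷_) (additive K x y) }
  ; injective = λ { {b ∷ x} {c ∷ y} e →
      cong₂ _∷_ (Vecₚ.∷-injectiveˡ e) (injective K (Vecₚ.∷-injectiveʳ e)) }
  ; property  = λ { (b ∷ y) → vanishes b (embed K y) (property K y) }
  }
  where
  K = kernel (ℓ ∘ (false ∷_)) (λ x y → ℓ-⊕ (false ∷ x) (false ∷ y))
  vanishes : ∀ b z → ℓ (false ∷ z) ≡ false → ℓ (b ∷ z) ≡ false
  vanishes false z p = p
  vanishes true  z p = trans (cong (ℓ ∘ (true ∷_)) (sym (⊕-identityˡ z)))
                             (trans (ℓ-⊕ (true ∷ 𝟎) (false ∷ z)) (cong₂ _xor_ eq p))

-- One functional at a time: `a` is restricted to the subspace found for the others, and its kernel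
-- there costs one dimension.
annihilator : ∀ (as : List (𝔽₂^ t)) → length as + m ≡ t →
              Embedding m t (λ x → All (λ a → a · x ≡ false) as)
annihilator []       refl = record
  { embed = id ; additive = λ _ _ → refl ; injective = id ; property = λ _ → [] }
annihilator {m = m} (a ∷ as) eq = record
  { embed     = embed M ∘ embed K
  ; additive  = λ x y → trans (cong (embed M) (additive K x y)) (additive M _ _)
  ; injective = injective K ∘ injective M
  ; property  = λ y → property K y ∷ property M (embed K y)
  }
  where
  M = annihilator {m = suc m} as (trans (ℕₚ.+-suc _ _) eq)
  K = kernel (λ y → a · embed M y) (λ x y → trans (cong (a ·_) (additive M x y)) (·-⊕ʳ a _ _))

vectors : ∀ m → List (𝔽₂^ m)
vectors zero    = [] ∷ []
vectors (suc m) = map (true ∷_) (vectors m) ++ map (false ∷_) (vectors m)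

length-vectors : ∀ m → length (vectors m) ≡ 2 ^ m
length-vectors zero    = refl
length-vectors (suc m) = trans (Listₚ.length-++ (map (true ∷_) (vectors m)))
  (cong₂ _+_ (trans (Listₚ.length-map _ (vectors m)) (length-vectors m))
             (trans (Listₚ.length-map _ (vectors m)) (trans (length-vectors m) (sym (ℕₚ.+-identityʳ _)))))

vectors-unique : ∀ m → Unique (vectors m)
vectors-unique zero    = [] ∷ []
vectors-unique (suc m) = Uniqueₚ.++⁺
  (Uniqueₚ.map⁺ Vecₚ.∷-injectiveʳ (vectors-unique m))
  (Uniqueₚ.map⁺ Vecₚ.∷-injectiveʳ (vectors-unique m))
  λ (p , q) → disjoint (∈ₚ.∈-map⁻ _ p) (∈ₚ.∈-map⁻ _ q)
  where
  disjoint : ∀ {v : 𝔽₂^ (suc m)} → ∃ (λ x → x ∈ vectors m × v ≡ true ∷ x) →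
             ∃ (λ x → x ∈ vectors m × v ≡ false ∷ x) → ⊥
  disjoint (_ , _ , refl) (_ , _ , ())

-- Pigeonhole: the `2 ^ m` distinct values of `f` do not fit into `F`.
avoid : (f : 𝔽₂^ m → 𝔽₂^ t) → Injective _≡_ _≡_ f → (F : List (𝔽₂^ t)) → length F < 2 ^ m →
        ∃[ y ] f y ∉ F
avoid {m} f inj F F< with Any.any? (λ y → ¬? (DecMembership._∈?_ _≟ᵥ_ (f y) F)) (vectors m)
... | yes p = Any.satisfied p
... | no ¬p = contradiction
  (unique⊆⇒length≤ (Uniqueₚ.map⁺ inj (vectors-unique m)) ⊆F)
  (ℕₚ.<⇒≱ (subst (length F <_) (sym (trans (Listₚ.length-map f (vectors m)) (length-vectors m))) F<))
  where
  ⊆F : ∀ {x} → x ∈ map f (vectors m) → x ∈ F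
  ⊆F x∈ with ∈ₚ.∈-map⁻ f x∈
  ... | y , y∈ , refl with DecMembership._∈?_ _≟ᵥ_ (f y) F
  ...   | yes q = q
  ...   | no ¬q = contradiction (Any.map (λ { refl → ¬q }) y∈) ¬p

-- The solutions of a consistent system of r equations form an affine space of dimension ≥ t − r.
abstract
  resolve : ∀ (as : List (𝔽₂^ t)) x₀ (F : List (𝔽₂^ t)) → length F < 2 ^ (t ∸ length as) → 1 ≤ length F →
            ∃[ x ] All (λ a → a · x ≡ a · x₀) as × x ∉ F
  resolve {t} as x₀ F F< 1≤F = x₀ ⊕ embed M y , All.map (λ {a} → same {a}) (property M y) , ∉F
    where
    as≤t : length as ≤ t
    as≤t with ℕₚ.≤-total (length as) t
    ... | inj₁ p = p
    -- With `t` or more equations the truncated difference is 0 and the bound reads `length F < 1`,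
    -- against `F` being nonempty.
    ... | inj₂ p = contradiction (subst (λ m → length F < 2 ^ m) (ℕₚ.m≤n⇒m∸n≡0 p) F<) (ℕₚ.≤⇒≯ 1≤F)
    M : Embedding (t ∸ length as) t (λ x → All (λ a → a · x ≡ false) as)
    M = annihilator as (ℕₚ.m+[n∸m]≡n as≤t)
    sol : ∃[ y ] x₀ ⊕ embed M y ∉ F
    sol = avoid (λ y → x₀ ⊕ embed M y) (injective M ∘ ⊕-cancelˡ x₀ _ _) F F<
    y : 𝔽₂^ (t ∸ length as)
    y = proj₁ sol
    ∉F : x₀ ⊕ embed M y ∉ F
    ∉F = proj₂ sol
    same : ∀ {a} → a · embed M y ≡ false → a · (x₀ ⊕ embed M y) ≡ a · x₀
    same {a} p = trans (·-⊕ʳ a x₀ _) (trans (cong (a · x₀ xor_) p) (Boolₚ.xor-identityʳ (a · x₀)))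

-- b is none of the sums of subfamilies of the list.
NotInSpan : List (𝔽₂^ t) → 𝔽₂^ t → Set
NotInSpan []       b = b ≢ 𝟎
NotInSpan (a ∷ as) b = NotInSpan as b × NotInSpan as (a ⊕ b)

data Independent {t} : List (𝔽₂^ t) → Set where
  []  : Independent []
  _∷_ : ∀ {a as} → NotInSpan as a → Independent as → Independent (a ∷ as)

nonzero⇒witness : (b : 𝔽₂^ t) → b ≢ 𝟎 → ∃[ y ] b · y ≡ true
nonzero⇒witness []          b≢0 = contradiction refl b≢0
nonzero⇒witness (true ∷ b)  _   = true ∷ 𝟎 , cong not (·-zeroʳ b)
nonzero⇒witness (false ∷ b) b≢0 with nonzero⇒witness b (b≢0 ∘ cong (false ∷_))
... | y , p = false ∷ y , p

-- A vector dual to `b`. By induction `y` and `z` annihilate the tail, with `b · y` and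
-- `(a ⊕ b) · z` equal to 1. One of `y`, `z`, `y ⊕ z` annihilates `a` as well.
separate : ∀ (as : List (𝔽₂^ t)) b → NotInSpan as b →
           ∃[ y ] b · y ≡ true × All (λ a → a · y ≡ false) as
separate []       b b≢0 with nonzero⇒witness b b≢0
... | y , p = y , p , []
separate (a ∷ as) b (∉₁ , ∉₂) with separate as b ∉₁ | separate as (a ⊕ b) ∉₂
... | y , by , asy | z , abz , asz with a · y in ay | a · z in az | trans (sym (·-⊕ˡ a b z)) abz
...   | false | _     | _  = y , by , ay ∷ asy
...   | true  | false | bz = z , bz , az ∷ asz
-- Here `a` is 1 on both vectors, hence 0 on their sum, while `b` is 1 on `y` and 0 on `z`.
...   | true  | true  | bz = y ⊕ z ,
  trans (·-⊕ʳ b y z) (cong₂ _xor_ by (Boolₚ.not-injective {y = false} bz)) ,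
  trans (·-⊕ʳ a y z) (cong₂ _xor_ ay az) ∷
  All.zipWith (λ { {c} (p , q) → trans (·-⊕ʳ c y z) (cong₂ _xor_ p q) }) (asy , asz)

-- A solution for the tail is corrected, if it fails at `a`, by a vector that is 1 on `f a` and 0 on
-- the tail.
interpolate : ∀ (f : A → 𝔽₂^ t) (β : A → Bool) as → Independent (map f as) →
        ∃[ x ] All (λ a → f a · x ≡ β a) as
interpolate f β []       []       = 𝟎 , []
interpolate f β (a ∷ as) (∉ ∷ ind) with interpolate f β as ind | separate (map f as) (f a) ∉
... | x , px | y , ay , asy with f a · x Boolₚ.≟ β a
...   | yes p = x , p ∷ px
...   | no ¬p = x ⊕ y , trans (·-⊕ʳ (f a) x y) (trans (cong (f a · x xor_) ay) (flip (f a · x) (β a) ¬p)) ∷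
  All.zipWith (λ { {c} (p , q) → trans (·-⊕ʳ (f c) x y) (trans (cong₂ _xor_ p q) (Boolₚ.xor-identityʳ (β c))) })
              (px , Allₚ.map⁻ asy)
  where
  flip : ∀ a b → a ≢ b → a xor true ≡ b
  flip true  true  a≢b = contradiction refl a≢b
  flip true  false _   = refl
  flip false true  _   = refl
  flip false false a≢b = contradiction refl a≢b

abstract
  -- Fewer than `t` equations leave at least two solutions, so one of them is not `𝟎`.
  solve-nonzero : ∀ (f : A → 𝔽₂^ t) (β : A → Bool) as → Independent (map f as) → length as < t →
                  ∃[ x ] All (λ a → f a · x ≡ β a) as × x ≢ 𝟎
  solve-nonzero {t = t} f β as ind as< with interpolate f β as ind
  ... | x₀ , px₀ with resolve (map f as) x₀ (𝟎 ∷ []) small (s≤s z≤n)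
    where
    small : 1 < 2 ^ (t ∸ length (map f as))
    small rewrite Listₚ.length-map f as with t ∸ length as | ℕₚ.m<n⇒0<n∸m as<
    ... | suc m | _ = ℕₚ.*-monoʳ-≤ 2 (ℕₚ.m^n>0 2 m)
  ...   | x , px , x∉ = x , All.zipWith (λ (p , q) → trans q p) (px₀ , Allₚ.map⁻ px) , x∉ ∘ here

-- Reducible configurations

does⇒ : ∀ {P : Set} (P? : Dec P) → does P? ≡ true → P
does⇒ (yes p) _ = p

dichotomy : ∀ b → b ≡ true ⊎ b ≡ false
dichotomy true  = inj₁ refl
dichotomy false = inj₂ refl

true≢false : ∀ {b} → b ≡ true → b ≡ false → ⊥
true≢false refl ()

two∈⇒2≤count : ∀ {n} (P : Fin n → Bool) {p q} → p ≢ q → P p ≡ true → P q ≡ true → 2 ≤ count P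
two∈⇒2≤count P {p} {q} p≢q Pp Pq = subst (2 ≤_) (length-members P)
  (unique⊆⇒length≤ {xs = p ∷ q ∷ []} ((p≢q ∷ []) ∷ ([] ∷ []))
    λ { (here refl) → ∈-members⁺ P Pp ; (there (here refl)) → ∈-members⁺ P Pq })

TriangleFree : ∀ {n} → Graph n → Set
TriangleFree G = ∀ {u v w} → Graph.adj G u v ≡ true → Graph.adj G v w ≡ true → Graph.adj G u w ≡ true → ⊥

module _ {n : ℕ} (G : Graph n) where

  open Graph G using (adj; symmetric; loopless)

  -- Neighbours and degrees are counted inside `S`, whether `v` lies in `S` or not.
  nbr : (Fin n → Bool) → Fin n → Fin n → Bool
  nbr S v u = S u ∧ adj v u

  deg : (Fin n → Bool) → Fin n → ℕ
  deg S v = count (nbr S v)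

  _∖_ : (Fin n → Bool) → (Fin n → Bool) → Fin n → Bool
  (S ∖ W) v = S v ∧ not (W v)

  hasDegree2 : (Fin n → Bool) → Fin n → Bool
  hasDegree2 S v = does (deg S v ℕₚ.≟ 2)

  twoNbr : (Fin n → Bool) → Fin n → Fin n → Bool
  twoNbr S u w = nbr S u w ∧ hasDegree2 S w

  bigNbr : (Fin n → Bool) → Fin n → Fin n → Bool
  bigNbr S v u = nbr S v u ∧ does (6 ≤? deg S u)

  ∉twoNbr : ∀ S u → twoNbr S u u ≡ false
  ∉twoNbr S u rewrite loopless u | Boolₚ.∧-zeroʳ (S u) = refl

  adj-sym : ∀ {u v} → adj u v ≡ true → adj v u ≡ true
  adj-sym {u} {v} e = trans (symmetric v u) e

  ∖-intro : ∀ {S W : Fin n → Bool} {v} → S v ≡ true → W v ≡ false → (S ∖ W) v ≡ true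
  ∖-intro Sv Wv rewrite Sv | Wv = refl

  deg-∖ : ∀ S W u → deg S u ≡ deg (S ∖ W) u + count (λ z → nbr S u z ∧ W z)
  deg-∖ S W u = trans (count-split (nbr S u) W)
    (cong (_+ count (λ z → nbr S u z ∧ W z)) (∑-cong (λ z → cong ⟦_⟧ (rearrange (S z) (adj u z) (W z)))))
    where
    rearrange : ∀ a b c → (a ∧ b) ∧ not c ≡ (a ∧ not c) ∧ b
    rearrange true  b c = Boolₚ.∧-comm b (not c)
    rearrange false b c = refl

  count-∖ : ∀ {S W} → (∀ v → W v ≡ true → S v ≡ true) → 0 < count W → count (S ∖ W) < count S
  count-∖ {S} {W} W⊆S 0<W = subst (count (S ∖ W) <_) (sym (count-split S W))
    (ℕₚ.m<m+n _ (ℕₚ.≤-trans 0<W (count-mono (λ v Wv → ∧-true (W⊆S v Wv) Wv))))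

  single : Fin n → Fin n → Bool
  single v z = does (z Fin.≟ v)

  single-refl : ∀ v → single v v ≡ true
  single-refl v = dec-true (v Fin.≟ v) refl

  single-≢ : ∀ {v z} → z ≢ v → single v z ≡ false
  single-≢ {v} {z} = dec-false (z Fin.≟ v)

  count-∖single : ∀ {S v} → S v ≡ true → count (S ∖ single v) < count S
  count-∖single {S} {v} Sv = count-∖ {S} {single v}
    (λ z e → trans (cong S (does⇒ (z Fin.≟ v) e)) Sv) (∈⇒0<count (single v) {v} (single-refl v))

  nbr⇒≢ : ∀ {S u v} → nbr S v u ≡ true → u ≢ v
  nbr⇒≢ {S} {u} p refl = true≢false (∧-trueʳ {S u} p) (loopless u)

  module _ (t : ℕ) (π : Fin n → Fin n → Bool)
           (π-sym : ∀ {u v} → adj u v ≡ true → π u v ≡ π v u) where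

    -- A partial solution on the subgraph induced by `S`. Since colours are nonzero, one colour
    -- alone is independent, and so are two different ones.
    record Colouring (S : Fin n → Bool) : Set where
      field
        colour   : Fin n → 𝔽₂^ t
        respects : ∀ {u v} → S u ≡ true → S v ≡ true → adj u v ≡ true → colour u · colour v ≡ π u v
        nonzero  : ∀ {v} → S v ≡ true → colour v ≢ 𝟎

    open Colouring

    abstract
      -- The neighbours of `u` impose `deg S u` linear equations on its colour. The present colour
      -- solves them, so the solutions form an affine space too large to lie inside `F`; no equation
      -- elsewhere involves `u`.
      recolour : ∀ {S} (C : Colouring S) u → S u ≡ true → ∀ F → length F < 2 ^ (t ∸ deg S u) → 𝟎 ∈ F →
                 ∃[ C′ ] (∀ {z} → z ≢ u → colour {S} C′ z ≡ colour C z) × colour C′ u ∉ F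
      recolour {S} C u Su F F< 𝟎∈F
        with resolve (map (colour C) (members (nbr S u))) (colour C u) F
               (subst (λ m → length F < 2 ^ (t ∸ m))
                 (sym (trans (Listₚ.length-map _ (members (nbr S u))) (length-members (nbr S u)))) F<)
               (nonempty 𝟎∈F)
        where
        nonempty : ∀ {F : List (𝔽₂^ t)} → 𝟎 ∈ F → 1 ≤ length F
        nonempty (here _)  = s≤s z≤n
        nonempty (there _) = s≤s z≤n
      ... | x , px , x∉F = C′ , kept , (x∉F ∘ subst (_∈ F) new)
        where
        c : Fin n → 𝔽₂^ t
        c z with z Fin.≟ u
        ... | yes _ = x
        ... | no  _ = colour C z

        new : c u ≡ x
        new with u Fin.≟ u
        ... | yes _ = refl
        ... | no ¬p = contradiction refl ¬p

        kept : ∀ {z} → z ≢ u → c z ≡ colour C z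
        kept {z} z≢u with z Fin.≟ u
        ... | yes p = contradiction p z≢u
        ... | no  _ = refl

        at-u : ∀ {z} → S z ≡ true → adj u z ≡ true → colour C z · x ≡ π z u
        at-u {z} Sz uz = trans
          (All.lookup px (∈ₚ.∈-map⁺ (colour C) (∈-members⁺ (nbr S u) (∧-true Sz uz))))
          (respects C Sz Su (adj-sym uz))

        C′ : Colouring S
        C′ .colour = c
        C′ .respects {a} {b} Sa Sb ab with a Fin.≟ u | b Fin.≟ u
        ... | yes refl | yes refl = ⊥-elim (true≢false ab (loopless a))
        ... | yes refl | no  _    = trans (·-comm x _) (trans (at-u Sb ab) (sym (π-sym ab)))
        ... | no  _    | yes refl = at-u Sa (adj-sym ab)
        ... | no  _    | no  _    = respects C Sa Sb ab
        C′ .nonzero {z} Sz with z Fin.≟ u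
        ... | yes _ = λ { refl → x∉F 𝟎∈F }
        ... | no  _ = nonzero C Sz

    abstract
      -- No edge joins two vertices of `W`, so their colours can be chosen separately, each from the
      -- already coloured neighbours.
      extend : ∀ {S} W (C : Colouring (S ∖ W)) →
               (∀ {w w′} → W w ≡ true → W w′ ≡ true → adj w w′ ≡ true → ⊥) →
               (∀ {w} → W w ≡ true → ∃[ ns ] (∀ z → nbr S w z ≡ true → z ∈ ns) ×
                  Independent (map (colour C) ns) × length ns < t) →
               Colouring S
      extend {S} W C W-indep locally = record
        { colour   = proj₁ ∘ new
        ; respects = λ {a} {b} → respects′ a b
        ; nonzero  = λ {z} → nz z
        }
        where
        new : ∀ z → ∃[ x ] (W z ≡ true → x ≢ 𝟎 × (∀ u → nbr S z u ≡ true → colour C u · x ≡ π u z)) ×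
                           (W z ≡ false → x ≡ colour C z)
        new z with W z in Wz
        ... | false = colour C z , (λ ()) , λ _ → refl
        ... | true with locally Wz
        ...   | ns , covers , ind , len with solve-nonzero (colour C) (λ u → π u z) ns ind len
        ...     | x , px , x≢𝟎 = x , (λ _ → x≢𝟎 , λ u zu → All.lookup px (covers u zu)) , λ ()

        respects′ : ∀ a b → S a ≡ true → S b ≡ true → adj a b ≡ true → proj₁ (new a) · proj₁ (new b) ≡ π a b
        respects′ a b Sa Sb ab with dichotomy (W a) | dichotomy (W b)
        ... | inj₁ Wa | inj₁ Wb = ⊥-elim (W-indep Wa Wb ab)
        ... | inj₁ Wa | inj₂ Wb = trans (cong (proj₁ (new a) ·_) (proj₂ (proj₂ (new b)) Wb))
          (trans (·-comm (proj₁ (new a)) (colour C b))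
            (trans (proj₂ (proj₁ (proj₂ (new a)) Wa) b (∧-true Sb ab)) (sym (π-sym ab))))
        ... | inj₂ Wa | inj₁ Wb = trans (cong (_· proj₁ (new b)) (proj₂ (proj₂ (new a)) Wa))
          (proj₂ (proj₁ (proj₂ (new b)) Wb) a (∧-true Sa (adj-sym ab)))
        ... | inj₂ Wa | inj₂ Wb = trans (cong₂ _·_ (proj₂ (proj₂ (new a)) Wa) (proj₂ (proj₂ (new b)) Wb))
          (respects C (∖-intro {S} {W} Sa Wa) (∖-intro {S} {W} Sb Wb) ab)

        nz : ∀ z → S z ≡ true → proj₁ (new z) ≢ 𝟎
        nz z Sz with dichotomy (W z)
        ... | inj₁ Wz = proj₁ (proj₁ (proj₂ (new z)) Wz)
        ... | inj₂ Wz = nonzero C (∖-intro {S} {W} Sz Wz) ∘ trans (sym (proj₂ (proj₂ (new z)) Wz))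

    single-indep : ∀ v {w w′} → single v w ≡ true → single v w′ ≡ true → adj w w′ ≡ true → ⊥
    single-indep v {w} {w′} p q e with does⇒ (w Fin.≟ v) p | does⇒ (w′ Fin.≟ v) q
    ... | refl | refl = true≢false e (loopless v)

    extend-deg≤1 : ∀ {S} v → deg S v ≤ 1 → 1 < t → Colouring (S ∖ single v) → Colouring S
    extend-deg≤1 {S} v d≤1 1<t C = extend (single v) C (single-indep v) locally
      where
      ok : ∀ ns → (∀ {z} → z ∈ ns → nbr S v z ≡ true) → length ns ≤ 1 → Independent (map (colour C) ns)
      ok [] _ _ = []
      ok (z ∷ []) nb _ =
        nonzero C (∖-intro {S} {single v} (∧-trueˡ (nb (here refl))) (single-≢ (nbr⇒≢ {S} (nb (here refl))))) ∷ []
      ok (_ ∷ _ ∷ _) _ (s≤s ())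
      short : length (members (nbr S v)) ≤ 1
      short = subst (_≤ 1) (sym (length-members (nbr S v))) d≤1
      locally : ∀ {w} → single v w ≡ true → ∃[ ns ] (∀ z → nbr S w z ≡ true → z ∈ ns) ×
                  Independent (map (colour C) ns) × length ns < t
      locally {w} p with does⇒ (w Fin.≟ v) p
      ... | refl = members (nbr S v) , (λ z → ∈-members⁺ (nbr S v)) ,
                   ok _ (∈-members⁻ (nbr S v)) short , ℕₚ.≤-<-trans short 1<t

    deg-∖single : ∀ {S v q} → S v ≡ true → adj q v ≡ true → deg (S ∖ single v) q < deg S q
    deg-∖single {S} {v} {q} Sv qv = subst (deg (S ∖ single v) q <_) (sym (deg-∖ S (single v) q))
      (ℕₚ.m<m+n _ (∈⇒0<count (λ z → nbr S q z ∧ single v z) (∧-true (∧-true Sv qv) (single-refl v))))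

    nbr-∖single : ∀ {S v z} → nbr S v z ≡ true → (S ∖ single v) z ≡ true
    nbr-∖single {S} {v} vz = ∖-intro {S} {single v} (∧-trueˡ vz) (single-≢ (nbr⇒≢ {S} vz))

    abstract
      -- Without `v` its neighbour `z` has degree at most 4, which leaves at least `7 - 4 = 3` free
      -- dimensions.
      room-deg5 : ∀ {S v z} → S v ≡ true → nbr S v z ≡ true → deg S z ≤ 5 → 7 ≤ t →
                  8 ≤ 2 ^ (t ∸ deg (S ∖ single v) z)
      room-deg5 {S} {v} {z} Sv vz dz 7≤t = ℕₚ.^-monoʳ-≤ 2 {3}
        (ℕₚ.∸-mono 7≤t (ℕₚ.≤-pred (ℕₚ.≤-trans (deg-∖single {S} Sv (adj-sym (∧-trueʳ {S z} vz))) dz)))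

    -- The colours of the three neighbours are made independent first: `q` is recoloured outside the
    -- span of `p`, then `s` outside the span of `p` and `q`.
    extend-deg3 : ∀ {S v} p q s → S v ≡ true → (∀ z → nbr S v z ≡ true → z ∈ s ∷ q ∷ p ∷ []) →
                  nbr S v p ≡ true → nbr S v q ≡ true → nbr S v s ≡ true →
                  p ≢ q → p ≢ s → q ≢ s → deg S q ≤ 5 → deg S s ≤ 5 → 7 ≤ t →
                  Colouring (S ∖ single v) → Colouring S
    extend-deg3 {S} {v} p q s Sv covers vp vq vs p≢q p≢s q≢s dq ds 7≤t C₀
      with recolour C₀ q (nbr-∖single {S} vq) (𝟎 ∷ colour C₀ p ∷ [])
             (ℕₚ.≤-trans (s≤s (s≤s (s≤s z≤n))) (room-deg5 {S} Sv vq dq 7≤t)) (here refl)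
    ... | C₁ , kept₁ , q∉
      with recolour C₁ s (nbr-∖single {S} vs)
             -- These four vectors are the span of the colours of `p` and `q`; at least eight
             -- colours are available.
             (𝟎 ∷ colour C₁ p ∷ colour C₁ q ∷ colour C₁ p ⊕ colour C₁ q ∷ [])
             (ℕₚ.≤-trans (s≤s (s≤s (s≤s (s≤s (s≤s z≤n))))) (room-deg5 {S} Sv vs ds 7≤t)) (here refl)
    ... | C₂ , kept₂ , s∉ = extend (single v) C₂ (single-indep v) locally
      where
      c = colour C₂
      cp≡ : c p ≡ colour C₁ p
      cp≡ = kept₂ p≢s
      cq≡ : c q ≡ colour C₁ q
      cq≡ = kept₂ q≢s
      q∉p : c p ⊕ c q ≢ 𝟎
      q∉p eq = q∉ (there (here (trans (sym cq≡) (trans (⊕≡𝟎⇒≡ (c p) (c q) eq) (trans cp≡ (kept₁ p≢q))))))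
      s∉p : c p ⊕ c s ≢ 𝟎
      s∉p eq = s∉ (there (here (trans (⊕≡𝟎⇒≡ (c p) (c s) eq) cp≡)))
      s∉q : c q ⊕ c s ≢ 𝟎
      s∉q eq = s∉ (there (there (here (trans (⊕≡𝟎⇒≡ (c q) (c s) eq) cq≡))))
      s∉pq : c p ⊕ (c q ⊕ c s) ≢ 𝟎
      s∉pq eq = s∉ (there (there (there (here
        (trans (⊕≡𝟎⇒≡ (c p ⊕ c q) (c s) (trans (⊕-assoc (c p) (c q) (c s)) eq)) (cong₂ _⊕_ cp≡ cq≡))))))
      independent : Independent (c s ∷ c q ∷ c p ∷ [])
      independent = ((nonzero C₂ (nbr-∖single {S} vs) , s∉p) , s∉q , s∉pq) ∷
                    (nonzero C₂ (nbr-∖single {S} vq) , q∉p) ∷ nonzero C₂ (nbr-∖single {S} vp) ∷ []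
      locally : ∀ {w} → single v w ≡ true → ∃[ ns ] (∀ z → nbr S w z ≡ true → z ∈ ns) ×
                  Independent (map c ns) × length ns < t
      locally {w} e with does⇒ (w Fin.≟ v) e
      ... | refl = s ∷ q ∷ p ∷ [] , covers , independent ,
                   ℕₚ.≤-trans (s≤s (s≤s (s≤s (s≤s z≤n)))) 7≤t

    otherNbr : (Fin n → Bool) → Fin n → Fin n → Fin n
    otherNbr S u w with members (nbr S w)
    ... | p ∷ q ∷ [] = if does (p Fin.≟ u) then q else p
    -- A default for vertices of degree other than 2.
    ... | _          = u

    otherNbr-spec : ∀ S {u w} → deg S w ≡ 2 → nbr S w u ≡ true →
      let z = otherNbr S u w in
      z ≢ u × nbr S w z ≡ true × (∀ x → nbr S w x ≡ true → x ∈ z ∷ u ∷ [])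
    otherNbr-spec S {u} {w} d≡2 wu
      with members (nbr S w) | trans (length-members (nbr S w)) d≡2 | members-unique (nbr S w)
         | (λ {x} → ∈-members⁺ (nbr S w) {x}) | (λ {x} → ∈-members⁻ (nbr S w) {x})
    ... | p ∷ q ∷ [] | _ | (p≢q ∷ []) ∷ _ | ⁺ | ⁻ with p Fin.≟ u
    ...   | yes refl = p≢q ∘ sym , ⁻ (there (here refl)) , λ x wx → swap (⁺ wx)
      where
      swap : ∀ {x} → x ∈ p ∷ q ∷ [] → x ∈ q ∷ p ∷ []
      swap (here e)         = there (here e)
      swap (there (here e)) = here e
    ...   | no p≢u with ⁺ wu
    ...     | here u≡p = contradiction (sym u≡p) p≢u
    ...     | there (here refl) = p≢u , ⁻ (here refl) , λ x wx → ⁺ wx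

    -- All neighbours of `u` of degree 2 are removed, and `u` is recoloured to differ from their
    -- other neighbours. Each removed vertex then sees two different nonzero colours, which are
    -- independent.
    extend-deg2 : ∀ {S u} → TriangleFree G → S u ≡ true → 2 < t →
                  1 + count (twoNbr S u) < 2 ^ (t ∸ deg (S ∖ twoNbr S u) u) →
                  Colouring (S ∖ twoNbr S u) → Colouring S
    extend-deg2 {S} {u} △-free Su 2<t room C₀
      with recolour C₀ u (∖-intro {S} {W} Su (∉twoNbr S u)) F
             (subst (λ m → suc m < 2 ^ (t ∸ deg (S ∖ W) u))
               (sym (trans (Listₚ.length-map _ (members W)) (length-members W))) room)
             (here refl)
      where
      W = twoNbr S u
      -- One forbidden colour for each vertex of `W`, and `𝟎`: this is the `1 + k` in the condition
      -- `room`.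
      F = 𝟎 ∷ map (λ w → colour C₀ (otherNbr S u w)) (members W)
    ... | C₁ , kept , u∉F = extend W C₁ W-indep locally
      where
      W = twoNbr S u
      adj-W : ∀ {w} → W w ≡ true → adj u w ≡ true
      adj-W {w} Ww = ∧-trueʳ {S w} (∧-trueˡ Ww)
      W-indep : ∀ {w w′} → W w ≡ true → W w′ ≡ true → adj w w′ ≡ true → ⊥
      W-indep Ww Ww′ ww′ = △-free (adj-W Ww) ww′ (adj-W Ww′)
      locally : ∀ {w} → W w ≡ true → ∃[ ns ] (∀ z → nbr S w z ≡ true → z ∈ ns) ×
                  Independent (map (colour C₁) ns) × length ns < t
      locally {w} Ww with otherNbr-spec S {u} {w} (does⇒ (deg S w ℕₚ.≟ 2) (∧-trueʳ {nbr S u w} Ww))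
                                        (∧-true Su (adj-sym (adj-W Ww)))
      ... | z≢u , wz , covers = z ∷ u ∷ [] , covers ,
        (nonzero C₁ (∖-intro {S} {W} (∧-trueˡ wz) z∉W) , distinct) ∷
        nonzero C₁ (∖-intro {S} {W} Su (∉twoNbr S u)) ∷ [] , 2<t
        where
        z = otherNbr S u w
        -- If `z` were in `W`, then `u`, `w` and `z` would form a triangle, so `z` does have a
        -- colour.
        z∉W : W z ≡ false
        z∉W = Boolₚ.¬-not λ Wz → W-indep Ww Wz (∧-trueʳ {S z} wz)
        distinct : colour C₁ u ⊕ colour C₁ z ≢ 𝟎
        distinct eq = u∉F (there (subst (_∈ map (λ w → colour C₀ (otherNbr S u w)) (members W))
          (trans (sym (kept z≢u)) (⊕≡𝟎⇒≡ (colour C₁ u) (colour C₁ z) eq))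
          (∈ₚ.∈-map⁺ _ (∈-members⁺ W Ww))))

    -- The absence of the three reducible configurations, in the form used for discharging. In
    -- `twoNbrs` the exponent subtracts the number of neighbours whose degree is not 2.
    record Irreducible (S : Fin n → Bool) : Set where
      field
        2≤deg     : ∀ {v} → S v ≡ true → 2 ≤ deg S v
        twoNbrs   : ∀ {u} → S u ≡ true → 0 < count (twoNbr S u) →
                    2 ^ (t ∸ deg (S ∖ twoNbr S u) u) ≤ 1 + count (twoNbr S u)
        deg3      : 7 ≤ t → ∀ {v} → S v ≡ true → deg S v ≡ 3 → 2 ≤ count (bigNbr S v)

    -- Unless two of the three neighbours have degree at least 6, two have degree at most 5 and can
    -- be recoloured.
    reduce-deg3 : ∀ {S v} → S v ≡ true → deg S v ≡ 3 → 7 ≤ t → Colouring (S ∖ single v) →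
                  Colouring S ⊎ 2 ≤ count (bigNbr S v)
    reduce-deg3 {S} {v} Sv d≡3 7≤t C
      with members (nbr S v) | trans (length-members (nbr S v)) d≡3 | members-unique (nbr S v)
         | (λ {x} → ∈-members⁺ (nbr S v) {x}) | (λ {x} → ∈-members⁻ (nbr S v) {x})
    ... | p ∷ q ∷ s ∷ [] | _ | (p≢q ∷ p≢s ∷ []) ∷ (q≢s ∷ []) ∷ _ | ⁺ | ⁻ =
      cases (6 ≤? deg S p) (6 ≤? deg S q) (6 ≤? deg S s)
      where
      vp = ⁻ (here refl)
      vq = ⁻ (there (here refl))
      vs = ⁻ (there (there (here refl)))
      big : ∀ {z} → nbr S v z ≡ true → 6 ≤ deg S z → bigNbr S v z ≡ true
      big {z} vz 6≤ = ∧-true vz (dec-true (6 ≤? deg S z) 6≤)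
      small : ∀ {z} → ¬ (6 ≤ deg S z) → deg S z ≤ 5
      small ¬6≤ = ℕₚ.≤-pred (ℕₚ.≰⇒> ¬6≤)
      rotate₁ : ∀ {x} → x ∈ p ∷ q ∷ s ∷ [] → x ∈ s ∷ q ∷ p ∷ []
      rotate₁ (here e)                 = there (there (here e))
      rotate₁ (there (here e))         = there (here e)
      rotate₁ (there (there (here e))) = here e
      rotate₂ : ∀ {x} → x ∈ p ∷ q ∷ s ∷ [] → x ∈ s ∷ p ∷ q ∷ []
      rotate₂ (here e)                 = there (here e)
      rotate₂ (there (here e))         = there (there (here e))
      rotate₂ (there (there (here e))) = here e
      rotate₃ : ∀ {x} → x ∈ p ∷ q ∷ s ∷ [] → x ∈ q ∷ p ∷ s ∷ []
      rotate₃ (here e)                 = there (here e)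
      rotate₃ (there (here e))         = here e
      rotate₃ (there (there (here e))) = there (there (here e))
      cases : Dec (6 ≤ deg S p) → Dec (6 ≤ deg S q) → Dec (6 ≤ deg S s) →
              Colouring S ⊎ 2 ≤ count (bigNbr S v)
      cases (yes bp) (yes bq) _        = inj₂ (two∈⇒2≤count (bigNbr S v) p≢q (big vp bp) (big vq bq))
      cases (yes bp) (no  _)  (yes bs) = inj₂ (two∈⇒2≤count (bigNbr S v) p≢s (big vp bp) (big vs bs))
      cases (no  _)  (yes bq) (yes bs) = inj₂ (two∈⇒2≤count (bigNbr S v) q≢s (big vq bq) (big vs bs))
      cases _        (no ¬bq) (no ¬bs) = inj₁ (extend-deg3 p q s Sv (λ _ → rotate₁ ∘ ⁺) vp vq vs
        p≢q p≢s q≢s (small ¬bq) (small ¬bs) 7≤t C)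
      cases (no ¬bp) _        (no ¬bs) = inj₁ (extend-deg3 q p s Sv (λ _ → rotate₂ ∘ ⁺) vq vp vs
        (p≢q ∘ sym) q≢s p≢s (small ¬bp) (small ¬bs) 7≤t C)
      cases (no ¬bp) (no ¬bq) _        = inj₁ (extend-deg3 s p q Sv (λ _ → rotate₃ ∘ ⁺) vs vp vq
        (p≢s ∘ sym) (q≢s ∘ sym) p≢q (small ¬bp) (small ¬bq) 7≤t C)

    colour-or-irreducible : TriangleFree G → 2 < t → ∀ S →
      (∀ S′ → count S′ < count S → Colouring S′) → Colouring S ⊎ Irreducible S
    colour-or-irreducible △-free 2<t S smaller
      with Finₚ.any? (λ v → (S v Boolₚ.≟ true) ×-dec (deg S v ≤? 1))
    ... | yes (v , Sv , d≤1) = inj₁ (extend-deg≤1 v d≤1 (ℕₚ.<-trans (s≤s (s≤s z≤n)) 2<t) (smaller _ (count-∖single Sv)))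
    ... | no ¬low
      with Finₚ.any? (λ u → (S u Boolₚ.≟ true) ×-dec (0 ℕₚ.<? count (twoNbr S u)) ×-dec
                            (1 + count (twoNbr S u) ℕₚ.<? 2 ^ (t ∸ deg (S ∖ twoNbr S u) u)))
    ... | yes (u , Su , 0<k , room) = inj₁ (extend-deg2 {S} {u} △-free Su 2<t room
      (smaller _ (count-∖ {S} {twoNbr S u} (λ z e → ∧-trueˡ (∧-trueˡ e)) 0<k)))
    ... | no ¬twos
      with Finₚ.any? (λ v → (S v Boolₚ.≟ true) ×-dec (deg S v ℕₚ.≟ 3) ×-dec (7 ≤? t) ×-dec
                            ¬? (2 ≤? count (bigNbr S v)))
    ... | yes (v , Sv , d≡3 , 7≤t , ¬big) = inj₁ (fromInj₁ (λ b → contradiction b ¬big)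
      (reduce-deg3 Sv d≡3 7≤t (smaller _ (count-∖single Sv))))
    ... | no ¬threes = inj₂ record
      { 2≤deg   = λ {v} Sv → ℕₚ.≰⇒> (λ d≤1 → ¬low (v , Sv , d≤1))
      ; twoNbrs = λ {u} Su 0<k → ℕₚ.≮⇒≥ (λ room → ¬twos (u , Su , 0<k , room))
      ; deg3    = λ 7≤t {v} Sv d≡3 → decidable-stable (2 ≤? count (bigNbr S v))
                    (λ ¬big → ¬threes (v , Sv , d≡3 , 7≤t , ¬big))
      }

    -- Induction on the number of vertices of `S`; an irreducible `S` must be empty, and then there
    -- is nothing to colour.
    colouring : TriangleFree G → 2 < t → (∀ S → 0 < count S → ¬ Irreducible S) → Colouring (λ _ → true)
    colouring △-free 2<t reducible = go _ _ ℕₚ.≤-refl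
      where
      go : ∀ m S → count S < m → Colouring S
      go (suc m) S (s≤s S≤m)
        with colour-or-irreducible △-free 2<t S (λ S′ S′<S → go m S′ (ℕₚ.<-≤-trans S′<S S≤m))
      ... | inj₁ C   = C
      ... | inj₂ irr with 0 ℕₚ.<? count S
      ...   | yes 0<S = contradiction irr (reducible S 0<S)
      ...   | no ¬0<S = record
        { colour   = λ _ → 𝟎
        ; respects = λ Su → contradiction (∈⇒0<count S Su) ¬0<S
        ; nonzero  = λ Su → contradiction (∈⇒0<count S Su) ¬0<S
        }

-- Discharging

n<2^n : ∀ n → n < 2 ^ n
n<2^n zero    = s≤s z≤n
n<2^n (suc n) = begin-strict
  suc n               ≤⟨ n<2^n n ⟩
  2 ^ n               <⟨ ℕₚ.m<m+n (2 ^ n) (ℕₚ.m^n>0 2 n) ⟩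
  2 ^ n + 2 ^ n       ≡⟨ cong (2 ^ n +_) (sym (ℕₚ.+-identityʳ (2 ^ n))) ⟩
  2 ^ suc n           ∎
  where open ℕₚ.≤-Reasoning

-- If `r + k < t`, then `2 ^ (t ∸ r)` is at least `2 ^ (k + 1)`, which exceeds `k + 1`. So a vertex
-- with a neighbour of degree 2 has degree at least `t`.
tight⇒t≤deg : ∀ {t r k} → 2 ^ (t ∸ r) ≤ 1 + k → t ≤ r + k
tight⇒t≤deg {t} {r} {k} tight = ℕₚ.≮⇒≥ λ r+k<t → ℕₚ.<-irrefl refl (begin-strict
  suc k         <⟨ n<2^n (suc k) ⟩
  2 ^ suc k     ≤⟨ ℕₚ.^-monoʳ-≤ 2 (ℕₚ.m+n≤o⇒m≤o∸n (suc k) (subst (_≤ t) (cong suc (ℕₚ.+-comm r k)) r+k<t)) ⟩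
  2 ^ (t ∸ r)   ≤⟨ tight ⟩
  suc k         ∎)
  where open ℕₚ.≤-Reasoning

tight⇒large : ∀ {t r k} → 5 ≤ t → 2 ^ (t ∸ r) ≤ 1 + k → 2 ≤ r ⊎ 10 ≤ k
tight⇒large {t} {r} {k} 5≤t tight with 2 ≤? r
... | yes 2≤r = inj₁ 2≤r
-- With `r ≤ 1` the left side is at least `2 ^ 4 = 16`, more than the 11 that is required of
-- `1 + k`.
... | no  2≰r = inj₂ (ℕₚ.≤-pred (ℕₚ.≤-trans (ℕₚ.m≤n+m 11 5)
  (ℕₚ.≤-trans (ℕₚ.^-monoʳ-≤ 2 {4} (ℕₚ.∸-mono 5≤t (ℕₚ.≤-pred (ℕₚ.≰⇒> 2≰r)))) tight)))

module _ {n : ℕ} (G : Graph n) (S : Fin n → Bool) where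

  open Graph G using (adj; symmetric; loopless)

  edgeIn : Fin n → Fin n → Bool
  edgeIn v u = S v ∧ nbr G S v u

  edgeIn-sym : ∀ v u → edgeIn v u ≡ edgeIn u v
  edgeIn-sym v u rewrite symmetric v u with S v | S u
  ... | true  | true  = refl
  ... | true  | false = refl
  ... | false | true  = refl
  ... | false | false = refl

  -- The degree sum of the induced subgraph, that is, twice its number of edges.
  volume : ℕ
  volume = ∑ λ v → count (edgeIn v)

  -- A vertex starts with `β` times its degree and must end with `α`. Exchanging the double sum
  -- shows that the total given equals the total received.
  discharge : ∀ {α β} (give : Fin n → Fin n → ℕ) →
    (∀ v → α * ⟦ S v ⟧ + ∑ (give v) ≤ β * count (edgeIn v) + ∑ (λ u → give u v)) →
    α * count S ≤ β * volume
  discharge {α} {β} give local = ℕₚ.+-cancelʳ-≤ (∑ λ v → ∑ (give v)) _ _ (begin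
    α * count S + ∑ (λ v → ∑ (give v))
      ≡⟨ cong (_+ ∑ (λ v → ∑ (give v))) (sym (∑-*ˡ α (⟦_⟧ ∘ S))) ⟩
    ∑ (λ v → α * ⟦ S v ⟧) + ∑ (λ v → ∑ (give v))
      ≡⟨ sym (∑-+ (λ v → α * ⟦ S v ⟧) (λ v → ∑ (give v))) ⟩
    ∑ (λ v → α * ⟦ S v ⟧ + ∑ (give v))
      ≤⟨ ∑-mono local ⟩
    ∑ (λ v → β * count (edgeIn v) + ∑ (λ u → give u v))
      ≡⟨ ∑-+ (λ v → β * count (edgeIn v)) (λ v → ∑ (λ u → give u v)) ⟩
    ∑ (λ v → β * count (edgeIn v)) + ∑ (λ v → ∑ (λ u → give u v))
      ≡⟨ cong₂ _+_ (∑-*ˡ β (λ v → count (edgeIn v))) (∑-swap (λ v u → give u v)) ⟩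
    β * volume + ∑ (λ v → ∑ (give v))
      ∎)
    where open ℕₚ.≤-Reasoning

  private
    d k r : Fin n → ℕ
    d = deg G S
    k = count ∘ twoNbr G S
    r v = deg G (_∖_ G S (twoNbr G S v)) v

  d≡r+k : ∀ v → d v ≡ r v + k v
  d≡r+k v = trans (deg-∖ G S (twoNbr G S v) v)
    (cong (r v +_) (∑-cong (λ u → cong ⟦_⟧ (idem (nbr G S v u)))))
    where
    idem : ∀ a {b} → a ∧ (a ∧ b) ≡ a ∧ b
    idem true  = refl
    idem false = refl

  module _ {t π} {π-sym : ∀ {u v} → adj u v ≡ true → π u v ≡ π v u} (5≤t : 5 ≤ t)
           (irr : Irreducible G t π π-sym S) where

    open Irreducible irr

    twoNbrs-cases : ∀ {v} → S v ≡ true → k v ≡ 0 ⊎ (t ≤ r v + k v × (2 ≤ r v ⊎ 10 ≤ k v))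
    twoNbrs-cases {v} Sv with k v ℕₚ.≟ 0
    ... | yes k≡0 = inj₁ k≡0
    ... | no  k≢0 = inj₂ (tight⇒t≤deg {t} tight , tight⇒large {t} 5≤t tight)
      where tight = twoNbrs Sv (ℕₚ.n≢0⇒n>0 k≢0)

  edgeIn-true : ∀ {v} → S v ≡ true → count (edgeIn v) ≡ d v
  edgeIn-true {v} Sv = ∑-cong (λ u → cong (λ b → ⟦ b ∧ nbr G S v u ⟧) Sv)

  edgesTo : Fin n → ℕ
  edgesTo v = count (λ u → edgeIn u v)

  edgesTo≡d : ∀ {v} → S v ≡ true → edgesTo v ≡ d v
  edgesTo≡d {v} Sv = trans (∑-cong (λ u → cong ⟦_⟧ (edgeIn-sym u v))) (edgeIn-true Sv)

  -- The initial charge is `2 d` and the target 6. Every vertex gives 1 to each neighbour of degree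
  -- 2, so a vertex of degree 2 ends with `4 + 2`.
  irreducible⇒volume₅ : ∀ {π} {π-sym : ∀ {u v} → adj u v ≡ true → π u v ≡ π v u} →
                        Irreducible G 5 π π-sym S → 6 * count S ≤ 2 * volume
  irreducible⇒volume₅ irr = discharge {6} {2} give local
    where
    open Irreducible irr
    open ℕₚ.≤-Reasoning
    give : Fin n → Fin n → ℕ
    give v u = ⟦ edgeIn v u ∧ hasDegree2 G S u ⟧

    received : ∀ v → S v ≡ true → d v ≡ 2 → ∑ (λ u → give u v) ≡ 2
    received v Sv d≡2 = trans (∑-cong pointwise) (trans (edgesTo≡d Sv) d≡2)
      where
      pointwise : ∀ u → give u v ≡ ⟦ edgeIn u v ⟧
      pointwise u rewrite dec-true (deg G S v ℕₚ.≟ 2) d≡2 = cong ⟦_⟧ (Boolₚ.∧-identityʳ _)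

    balance : ∀ r k x → 2 ≤ r + k → (r + k ≡ 2 → x ≡ 2) → k ≡ 0 ⊎ (5 ≤ r + k × (2 ≤ r ⊎ 10 ≤ k)) →
              6 + k ≤ 2 * (r + k) + x
    balance r k x 2≤d got (inj₁ refl) with r + 0 ℕₚ.≟ 2
    ... | yes d≡2 rewrite d≡2 | got refl = ℕₚ.≤-refl
    ... | no  d≢2 = ℕₚ.≤-trans (ℕₚ.*-monoʳ-≤ 2 {3} (ℕₚ.≤∧≢⇒< 2≤d (d≢2 ∘ sym))) (ℕₚ.m≤m+n _ x)
    -- After giving away `k`, what remains is `2 d - k = d + r`, at least `5 + 2`.
    balance r k x _ _ (inj₂ (5≤d , inj₁ 2≤r)) = begin
      6 + k                   ≤⟨ ℕₚ.+-monoˡ-≤ k (ℕₚ.m≤n+m 6 1) ⟩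
      5 + 2 + k               ≤⟨ ℕₚ.+-monoˡ-≤ k (ℕₚ.+-mono-≤ 5≤d 2≤r) ⟩
      r + k + r + k           ≡⟨ solve 2 (λ r k → r :+ k :+ r :+ k := con 2 :* (r :+ k)) refl r k ⟩
      2 * (r + k)             ≤⟨ ℕₚ.m≤m+n _ x ⟩
      2 * (r + k) + x         ∎
      where open +-*-Solver
    balance r k x _ _ (inj₂ (_ , inj₂ 10≤k)) = begin
      6 + k                   ≤⟨ ℕₚ.+-monoˡ-≤ k (ℕₚ.≤-trans (ℕₚ.m≤n+m 6 4) 10≤k) ⟩
      k + k                   ≤⟨ ℕₚ.+-mono-≤ (ℕₚ.m≤n+m k r) (ℕₚ.m≤n+m k r) ⟩
      r + k + (r + k)         ≡⟨ solve 1 (λ a → a :+ a := con 2 :* a) refl (r + k) ⟩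
      2 * (r + k)             ≤⟨ ℕₚ.m≤m+n _ x ⟩
      2 * (r + k) + x         ∎
      where open +-*-Solver

    local : ∀ v → 6 * ⟦ S v ⟧ + ∑ (give v) ≤ 2 * count (edgeIn v) + ∑ (λ u → give u v)
    local v with dichotomy (S v)
    ... | inj₂ Sv = ℕₚ.≤-trans (ℕₚ.≤-reflexive (cong₂ _+_ (cong (λ b → 6 * ⟦ b ⟧) Sv) (∑-zero given))) z≤n
      where
      given : ∀ u → give v u ≡ 0
      given u rewrite Sv = refl
    ... | inj₁ Sv = begin
      6 * ⟦ S v ⟧ + ∑ (give v)
        ≡⟨ cong₂ _+_ (cong (λ b → 6 * ⟦ b ⟧) Sv)
             (∑-cong (λ u → cong (λ b → ⟦ (b ∧ nbr G S v u) ∧ hasDegree2 G S u ⟧) Sv)) ⟩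
      6 + k v
        ≤⟨ balance (r v) (k v) _ (subst (2 ≤_) (d≡r+k v) (2≤deg Sv))
             (λ e → received v Sv (trans (d≡r+k v) e))
             (twoNbrs-cases {t = 5} ℕₚ.≤-refl irr Sv) ⟩
      2 * (r v + k v) + ∑ (λ u → give u v)
        ≡⟨ cong (λ m → 2 * m + ∑ (λ u → give u v)) (sym (trans (edgeIn-true Sv) (d≡r+k v))) ⟩
      2 * count (edgeIn v) + ∑ (λ u → give u v)
        ∎

  -- The initial charge is `6 d` and the target 20. Every vertex gives 4 to each neighbour of degree
  -- 2, and a vertex of degree at least 6 also gives 1 to each neighbour of degree 3. Degree 2 ends
  -- with `12 + 8`, degree 3 with at least `18 + 2`, and degrees 4 and 5 keep at least 24.
  irreducible⇒volume₇ : ∀ {π} {π-sym : ∀ {u v} → adj u v ≡ true → π u v ≡ π v u} →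
                        Irreducible G 7 π π-sym S → 20 * count S ≤ 6 * volume
  irreducible⇒volume₇ irr = discharge {20} {6} give local
    where
    open Irreducible irr
    open ℕₚ.≤-Reasoning
    two three big : Fin n → Bool
    two   = hasDegree2 G S
    three v = does (d v ℕₚ.≟ 3)
    big   v = does (6 ≤? d v)

    give : Fin n → Fin n → ℕ
    give v u = 4 * ⟦ edgeIn v u ∧ two u ⟧ + ⟦ edgeIn v u ∧ (three u ∧ big v) ⟧

    s : Fin n → ℕ
    s v = count (λ u → edgeIn v u ∧ (three u ∧ big v))

    given : ∀ {v} → S v ≡ true → ∑ (give v) ≡ 4 * k v + s v
    given {v} Sv = trans (∑-+ (λ u → 4 * ⟦ edgeIn v u ∧ two u ⟧) (λ u → ⟦ edgeIn v u ∧ (three u ∧ big v) ⟧)) (cong (_+ s v) (trans (∑-*ˡ 4 (λ u → ⟦ edgeIn v u ∧ two u ⟧))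
      (cong (4 *_) (∑-cong (λ u → cong (λ b → ⟦ (b ∧ nbr G S v u) ∧ two u ⟧) Sv)))))

    s-small : ∀ {v} → d v ≤ 5 → s v ≡ 0
    s-small {v} d≤5 = ∑-zero λ u → cong ⟦_⟧
      (trans (cong (λ b → edgeIn v u ∧ (three u ∧ b)) (dec-false (6 ≤? d v) (ℕₚ.≤⇒≯ d≤5)))
        (trans (cong (edgeIn v u ∧_) (Boolₚ.∧-zeroʳ (three u))) (Boolₚ.∧-zeroʳ (edgeIn v u))))

    -- Neighbours of degree 3 are among those whose degree is not 2.
    s≤r : ∀ v → s v ≤ r v
    s≤r v = count-mono pointwise
      where
      pointwise : ∀ u → edgeIn v u ∧ (three u ∧ big v) ≡ true → nbr G (_∖_ G S (twoNbr G S v)) v u ≡ true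
      pointwise u e = ∧-true (∖-intro G {S} {twoNbr G S v} {u} Su ¬two) vu
        where
        Su = ∧-trueˡ {S u} (∧-trueʳ {S v} (∧-trueˡ {edgeIn v u} e))
        vu = ∧-trueʳ {S u} (∧-trueʳ {S v} (∧-trueˡ {edgeIn v u} e))
        d≡3 : d u ≡ 3
        d≡3 = does⇒ (d u ℕₚ.≟ 3) (∧-trueˡ {three u} (∧-trueʳ {edgeIn v u} e))
        ¬two : twoNbr G S v u ≡ false
        ¬two = trans (cong (nbr G S v u ∧_) (dec-false (d u ℕₚ.≟ 2) λ d≡2 → 3≢2 (trans (sym d≡3) d≡2)))
                     (Boolₚ.∧-zeroʳ (nbr G S v u))
          where
          3≢2 : 3 ≢ 2
          3≢2 ()

    received₂ : ∀ {v} → S v ≡ true → d v ≡ 2 → 8 ≤ ∑ (λ u → give u v)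
    received₂ {v} Sv d≡2 = begin
      8                                         ≡⟨ cong (4 *_) (sym (trans (edgesTo≡d Sv) d≡2)) ⟩
      4 * edgesTo v                             ≡⟨ cong (4 *_) (∑-cong pointwise) ⟩
      4 * count (λ u → edgeIn u v ∧ two v)      ≡⟨ sym (∑-*ˡ 4 (λ u → ⟦ edgeIn u v ∧ two v ⟧)) ⟩
      ∑ (λ u → 4 * ⟦ edgeIn u v ∧ two v ⟧)      ≤⟨ ∑-mono (λ u → ℕₚ.m≤m+n (4 * ⟦ edgeIn u v ∧ two v ⟧) _) ⟩
      ∑ (λ u → give u v)                        ∎
      where
      pointwise : ∀ u → ⟦ edgeIn u v ⟧ ≡ ⟦ edgeIn u v ∧ two v ⟧
      pointwise u rewrite dec-true (d v ℕₚ.≟ 2) d≡2 = cong ⟦_⟧ (sym (Boolₚ.∧-identityʳ _))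

    received₃ : ∀ {v} → S v ≡ true → d v ≡ 3 → 2 ≤ ∑ (λ u → give u v)
    received₃ {v} Sv d≡3 = begin
      2                                              ≤⟨ deg3 ℕₚ.≤-refl Sv d≡3 ⟩
      count (bigNbr G S v)                           ≤⟨ count-mono pointwise ⟩
      count (λ u → edgeIn u v ∧ (three v ∧ big u))   ≤⟨ ∑-mono (λ u → ℕₚ.m≤n+m _ (4 * ⟦ edgeIn u v ∧ two v ⟧)) ⟩
      ∑ (λ u → give u v)                             ∎
      where
      pointwise : ∀ u → bigNbr G S v u ≡ true → edgeIn u v ∧ (three v ∧ big u) ≡ true
      pointwise u e = ∧-true
        (trans (edgeIn-sym u v) (∧-true Sv (∧-trueˡ {nbr G S v u} e)))
        (∧-true (dec-true (d v ℕₚ.≟ 3) d≡3) (∧-trueʳ {nbr G S v u} e))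

    balance-large : ∀ r k → 6 ≤ r + k → k ≡ 0 ⊎ (7 ≤ r + k × (2 ≤ r ⊎ 10 ≤ k)) →
                    20 + (4 * k + r) ≤ 6 * (r + k)
    balance-large r k 6≤d cases = begin
      20 + (4 * k + r)                      ≤⟨ ℕₚ.+-monoˡ-≤ (4 * k + r) (enough cases) ⟩
      5 * r + 2 * k + (4 * k + r)           ≡⟨ solve 2 (λ r k → con 5 :* r :+ con 2 :* k :+ (con 4 :* k :+ r)
                                                 := con 6 :* (r :+ k)) refl r k ⟩
      6 * (r + k)                           ∎
      where
      open +-*-Solver
      -- A vertex giving `4 k + r` keeps `5 r + 2 k`. This is at least 30 if `k` is 0; otherwise it
      -- is `2 d + 3 r`, at least `14 + 6`, or at least `2 * 10`.
      enough : k ≡ 0 ⊎ (7 ≤ r + k × (2 ≤ r ⊎ 10 ≤ k)) → 20 ≤ 5 * r + 2 * k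
      enough (inj₁ refl) = ℕₚ.≤-trans (ℕₚ.m≤n+m 20 10)
        (ℕₚ.≤-trans (ℕₚ.*-monoʳ-≤ 5 (subst (6 ≤_) (ℕₚ.+-identityʳ r) 6≤d)) (ℕₚ.m≤m+n _ _))
      enough (inj₂ (7≤d , inj₁ 2≤r)) = ℕₚ.≤-trans (ℕₚ.+-mono-≤ (ℕₚ.*-monoʳ-≤ 2 7≤d) (ℕₚ.*-monoʳ-≤ 3 2≤r))
        (ℕₚ.≤-reflexive (solve 2 (λ r k → con 2 :* (r :+ k) :+ con 3 :* r := con 5 :* r :+ con 2 :* k) refl r k))
      enough (inj₂ (_ , inj₂ 10≤k)) = ℕₚ.≤-trans (ℕₚ.*-monoʳ-≤ 2 10≤k) (ℕₚ.m≤n+m _ (5 * r))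

    sevenCases⇒k≡0 : ∀ {r k} → r + k ≤ 5 → k ≡ 0 ⊎ (7 ≤ r + k × (2 ≤ r ⊎ 10 ≤ k)) → k ≡ 0
    sevenCases⇒k≡0 d≤5 (inj₁ k≡0)        = k≡0
    sevenCases⇒k≡0 d≤5 (inj₂ (7≤d , _)) =
      contradiction (ℕₚ.≤-trans 7≤d d≤5) (ℕₚ.<⇒≱ (s≤s (s≤s (s≤s (s≤s (s≤s (s≤s z≤n)))))))

    balance : ∀ {v} → S v ≡ true → 20 + (4 * k v + s v) ≤ 6 * d v + ∑ (λ u → give u v)
    balance {v} Sv with 6 ≤? d v
    ... | yes 6≤d = begin
      20 + (4 * k v + s v)      ≤⟨ ℕₚ.+-monoʳ-≤ 20 (ℕₚ.+-monoʳ-≤ (4 * k v) (s≤r v)) ⟩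
      20 + (4 * k v + r v)      ≤⟨ balance-large (r v) (k v) (subst (6 ≤_) (d≡r+k v) 6≤d)
                                     (twoNbrs-cases {t = 7} (ℕₚ.m≤n+m 5 2) irr Sv) ⟩
      6 * (r v + k v)           ≡⟨ cong (6 *_) (sym (d≡r+k v)) ⟩
      6 * d v                   ≤⟨ ℕₚ.m≤m+n _ _ ⟩
      6 * d v + ∑ (λ u → give u v) ∎
    ... | no  6≰d = begin
      20 + (4 * k v + s v)      ≡⟨ cong₂ (λ a b → 20 + (4 * a + b)) k≡0 (s-small d≤5) ⟩
      20                        ≤⟨ small (d v) refl (2≤deg Sv) ⟩
      6 * d v + ∑ (λ u → give u v) ∎
      where
      d≤5 = ℕₚ.≤-pred (ℕₚ.≰⇒> 6≰d)
      k≡0 = sevenCases⇒k≡0 (subst (_≤ 5) (d≡r+k v) d≤5) (twoNbrs-cases {t = 7} (ℕₚ.m≤n+m 5 2) irr Sv)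
      small : ∀ m → d v ≡ m → 2 ≤ m → 20 ≤ 6 * m + ∑ (λ u → give u v)
      small 1 _ (s≤s ())
      small 2 e _ = ℕₚ.+-monoʳ-≤ 12 (received₂ Sv e)
      small 3 e _ = ℕₚ.+-monoʳ-≤ 18 (received₃ Sv e)
      small (suc (suc (suc (suc m)))) _ _ = ℕₚ.≤-trans (ℕₚ.m≤n+m 20 4)
        (ℕₚ.≤-trans (ℕₚ.*-monoʳ-≤ 6 (ℕₚ.m≤m+n 4 m)) (ℕₚ.m≤m+n _ _))

    local : ∀ v → 20 * ⟦ S v ⟧ + ∑ (give v) ≤ 6 * count (edgeIn v) + ∑ (λ u → give u v)
    local v with dichotomy (S v)
    ... | inj₂ Sv = ℕₚ.≤-trans (ℕₚ.≤-reflexive (cong₂ _+_ (cong (λ b → 20 * ⟦ b ⟧) Sv) (∑-zero nothing))) z≤n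
      where
      nothing : ∀ u → give v u ≡ 0
      nothing u rewrite Sv = refl
    ... | inj₁ Sv = begin
      20 * ⟦ S v ⟧ + ∑ (give v)    ≡⟨ cong₂ _+_ (cong (λ b → 20 * ⟦ b ⟧) Sv) (given Sv) ⟩
      20 + (4 * k v + s v)         ≤⟨ balance Sv ⟩
      6 * d v + ∑ (λ u → give u v) ≡⟨ cong (λ m → 6 * m + ∑ (λ u → give u v)) (sym (edgeIn-true Sv)) ⟩
      6 * count (edgeIn v) + ∑ (λ u → give u v) ∎

-- Merging classes along the edges of a pair of dual graphs

-- The identification of `a` with `b`: the index `a` is removed and its points take the index of
-- `b`.
contract : ∀ {m} {a b : Fin (suc m)} → a ≢ b → Fin (suc m) → Fin m
contract {a = a} a≢b x with a Fin.≟ x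
... | yes _   = punchOut a≢b
... | no  a≢x = punchOut a≢x

contract-≡ : ∀ {m} {a b : Fin (suc m)} (a≢b : a ≢ b) → contract a≢b a ≡ contract a≢b b
contract-≡ {a = a} {b} a≢b with a Fin.≟ a | a Fin.≟ b
... | no a≢a | _       = contradiction refl a≢a
... | yes _  | yes a≡b = contradiction a≡b a≢b
... | yes _  | no _    = Finₚ.punchOut-cong a refl

contract-punchIn : ∀ {m} {a b : Fin (suc m)} (a≢b : a ≢ b) y → contract a≢b (punchIn a y) ≡ y
contract-punchIn {a = a} a≢b y with a Fin.≟ punchIn a y
... | yes e = contradiction (sym e) (Finₚ.punchInᵢ≢i a y)
... | no  _ = trans (Finₚ.punchOut-cong a refl) (Finₚ.punchOut-punchIn a)

-- A partition into exactly `size` classes; the representatives `member` witness that none is empty.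
record Quotient (k : ℕ) : Set where
  constructor quot
  field
    {size}  : ℕ
    class   : Fin k → Fin size
    member  : Fin size → Fin k
    section : ∀ y → class (member y) ≡ y

open Quotient public

module Merging {E : Set} {k : ℕ} (s t : E → Fin k) where

  Joined : Quotient k → E → Set
  Joined Q i = class Q (s i) ≡ class Q (t i)

  joined? : ∀ Q i → Dec (Joined Q i)
  joined? Q i = class Q (s i) Fin.≟ class Q (t i)

  -- The decision is a separate argument so that lemmas can split on it without unfolding `joined?`.
  join : ∀ Q i → Dec (Joined Q i) → Quotient k
  join Q i (yes _) = Q
  join (quot {zero}  c m e) i (no _) with c (s i)
  ... | ()
  join (quot {suc z} c m e) i (no a≢b) = quot (contract a≢b ∘ c) (m ∘ punchIn (c (s i)))
    λ y → trans (cong (contract a≢b) (e (punchIn (c (s i)) y))) (contract-punchIn a≢b y)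

  merge : Quotient k → E → Quotient k
  merge Q i = join Q i (joined? Q i)

  -- The connected components of the graph with edge list `L`. The head of the list is merged last.
  quotient : List E → Quotient k
  quotient []      = quot id id λ _ → refl
  quotient (i ∷ L) = merge (quotient L) i

  cost : ∀ {Q i} → Dec (Joined Q i) → ℕ
  cost (yes _) = 0
  cost (no _)  = 1

  size-join : ∀ Q i dec → size Q ≡ size (join Q i dec) + cost {Q} {i} dec
  size-join Q i (yes _) = sym (ℕₚ.+-identityʳ _)
  size-join (quot {zero}  c m e) i (no _) with c (s i)
  ... | ()
  size-join (quot {suc z} c m e) i (no _) = ℕₚ.+-comm 1 z

  join-joined : ∀ Q i dec → Joined (join Q i dec) i
  join-joined Q i (yes p) = p
  join-joined (quot {zero}  c m e) i (no _) with c (s i)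
  ... | ()
  join-joined (quot {suc z} c m e) i (no a≢b) = contract-≡ a≢b

  join-coarser : ∀ Q i dec {x y} → class Q x ≡ class Q y → class (join Q i dec) x ≡ class (join Q i dec) y
  join-coarser Q i (yes _) eq = eq
  join-coarser (quot {zero}  c m e) i (no _) eq with c (s i)
  ... | ()
  join-coarser (quot {suc z} c m e) i (no a≢b) eq = cong (contract a≢b) eq

  ∈⇒joined : ∀ {L i} → i ∈ L → Joined (quotient L) i
  ∈⇒joined {j ∷ L} (here refl) = join-joined (quotient L) j (joined? (quotient L) j)
  ∈⇒joined {j ∷ L} (there i∈L) = join-coarser (quotient L) j (joined? (quotient L) j) (∈⇒joined i∈L)

  Covers : ∀ {q} (Q : Quotient k) → (Fin q → Fin (size Q)) → List E → Set
  Covers Q g L = ∀ {i} → i ∈ L → (∃[ a ] class Q (s i) ≡ g a) × (∃[ b ] class Q (t i) ≡ g b)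

  -- If all ends lie in `q + 1` listed classes, at most `q` merges occur: each one identifies two
  -- listed classes and shortens the list by one.
  size-foldl : ∀ q L Q (g : Fin (suc q) → Fin (size Q)) → Covers Q g L →
               size Q ≤ size (List.foldl merge Q L) + q
  size-foldl q []      Q g covers = ℕₚ.m≤m+n _ q
  size-foldl q (i ∷ L) Q g covers = step (joined? Q i)
    where
    step : (dec : Dec (Joined Q i)) → size Q ≤ size (List.foldl merge (join Q i dec) L) + q
    step (yes _) = size-foldl q L Q g (covers ∘ there)
    step (no a≢b) = go Q g (covers (here refl)) (covers ∘ there) a≢b
      where
      go : ∀ {q} (Q : Quotient k) (g : Fin (suc q) → Fin (size Q)) →
           (∃[ a ] class Q (s i) ≡ g a) × (∃[ b ] class Q (t i) ≡ g b) → Covers Q g L →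
           (a≢b : ¬ Joined Q i) → size Q ≤ size (List.foldl merge (join Q i (no a≢b)) L) + q
      go (quot {zero} c m e) g _ _ a≢b with c (s i)
      ... | ()
      -- With a single listed class both ends already agree.
      go {zero} (quot {suc z} c m e) g ((zero , pa) , (zero , pb)) _ a≢b = contradiction (trans pa (sym pb)) a≢b
      go {suc q} (quot {suc z} c m e) g ((a , pa) , (b , pb)) rest a≢b =
        subst (suc z ≤_) (sym (ℕₚ.+-suc _ q))
          (s≤s (size-foldl q L _ g′ (λ i∈ → through (proj₁ (rest i∈)) , through (proj₂ (rest i∈)))))
        where
        i≢j : a ≢ b
        i≢j refl = a≢b (trans pa (sym pb))
        g′ : Fin (suc q) → Fin z
        g′ = contract a≢b ∘ g ∘ punchIn a
        through : ∀ {x} → (∃[ l ] c x ≡ g l) → ∃[ l ] contract a≢b (c x) ≡ g′ l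
        through (l , pl) with a Fin.≟ l
        ... | no a≢l   = punchOut a≢l ,
          cong (contract a≢b) (trans pl (cong g (sym (Finₚ.punchIn-punchOut a≢l))))
        -- The dropped entry `a` is replaced by `b`, with which its class has been merged.
        ... | yes refl = punchOut i≢j ,
          trans (cong (contract a≢b) (trans pl (sym pa)))
          (trans (contract-≡ a≢b)
          (cong (contract a≢b) (trans pb (cong g (sym (Finₚ.punchIn-punchOut i≢j))))))

  quotient-ʳ++ : ∀ L M → quotient (L ʳ++ M) ≡ List.foldl merge (quotient M) L
  quotient-ʳ++ []      M = refl
  quotient-ʳ++ (i ∷ L) M = quotient-ʳ++ L (i ∷ M)

  size-ʳ++ : ∀ {q} L M (g : Fin (suc q) → Fin (size (quotient M))) → Covers (quotient M) g L →
             size (quotient M) ≤ size (quotient (L ʳ++ M)) + q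
  size-ʳ++ {q} L M g covers =
    subst (λ Q → size (quotient M) ≤ size Q + q) (sym (quotient-ʳ++ L M)) (size-foldl q L (quotient M) g covers)

-- Two graphs on one edge set, such as a plane graph and its dual. The hypothesis says that a cut of
-- one and a cut of the other never have exactly one common edge.
module Orthogonal {E : Set} {v f : ℕ} (vs vt : E → Fin v) (fs ft : E → Fin f)
  (orthogonal : ∀ (C : Fin f → Bool) (X : Fin v → Bool) i → C (fs i) ≢ C (ft i) → X (vs i) ≢ X (vt i) →
     ¬ (∀ j → j ≡ i ⊎ C (fs j) ≡ C (ft j) ⊎ X (vs j) ≡ X (vt j))) where

  module V = Merging vs vt
  module F = Merging fs ft

  does-cong : ∀ {m} {a b c : Fin m} → b ≡ c → does (b Fin.≟ a) ≡ does (c Fin.≟ a)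
  does-cong refl = refl

  does-≢ : ∀ {m} {a b : Fin m} → a ≢ b → does (a Fin.≟ a) ≢ does (b Fin.≟ a)
  does-≢ {a = a} {b} a≢b eq
    with trans (sym (dec-true (a Fin.≟ a) refl)) (trans eq (dec-false (b Fin.≟ a) (a≢b ∘ sym)))
  ... | ()

  -- If `i` merged on both sides, the class of one of its ends would give a cut on each side. Edges
  -- in `A` avoid the first cut and edges in `B` the second, so `i` would be their only common edge.
  cost≤1 : ∀ {i A B} → (∀ j → j ≡ i ⊎ j ∈ A ⊎ j ∈ B) →
           V.cost {V.quotient B} {i} (V.joined? (V.quotient B) i) +
           F.cost {F.quotient A} {i} (F.joined? (F.quotient A) i) ≤ 1
  cost≤1 {i} {A} {B} all with V.joined? (V.quotient B) i | F.joined? (F.quotient A) i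
  ... | yes _ | yes _ = z≤n
  ... | yes _ | no  _ = s≤s z≤n
  ... | no  _ | yes _ = s≤s z≤n
  ... | no ¬v | no ¬f = ⊥-elim (orthogonal
    (λ x → does (class (F.quotient A) x Fin.≟ class (F.quotient A) (fs i)))
    (λ x → does (class (V.quotient B) x Fin.≟ class (V.quotient B) (vs i)))
    i (does-≢ ¬f) (does-≢ ¬v) λ j → constant j (all j))
    where
    constant : ∀ j → j ≡ i ⊎ j ∈ A ⊎ j ∈ B → j ≡ i ⊎ _ ⊎ _
    constant j (inj₁ j≡i)        = inj₁ j≡i
    constant j (inj₂ (inj₁ j∈A)) = inj₂ (inj₁ (does-cong (F.∈⇒joined j∈A)))
    constant j (inj₂ (inj₂ j∈B)) = inj₂ (inj₂ (does-cong (V.∈⇒joined j∈B)))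

  -- The edges of `K` are merged in opposite orders on the two sides. When `x` has its turn, every
  -- other edge is merged already on exactly the side where `cost≤1` wants it, so each edge costs at
  -- most one class in total.
  exchange : ∀ K H A → (∀ j → j ∈ A ⊎ j ∈ K ++ H) →
             size (V.quotient H) + size (F.quotient A) ≤
             size (V.quotient (K ++ H)) + size (F.quotient (K ʳ++ A)) + length K
  exchange []      H A all = ℕₚ.≤-reflexive (sym (ℕₚ.+-identityʳ _))
  exchange (x ∷ K) H A all = begin
    vH + size (F.quotient A)          ≡⟨ cong (vH +_) (F.size-join (F.quotient A) x (F.joined? (F.quotient A) x)) ⟩
    vH + (fx + cf)                    ≡⟨ sym (ℕₚ.+-assoc vH fx cf) ⟩
    vH + fx + cf                      ≤⟨ ℕₚ.+-monoˡ-≤ cf (exchange K H (x ∷ A) all′) ⟩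
    size (V.quotient (K ++ H)) + fK + length K + cf
      ≡⟨ cong (λ m → m + fK + length K + cf) (V.size-join (V.quotient (K ++ H)) x (V.joined? (V.quotient (K ++ H)) x)) ⟩
    vx + cv + fK + length K + cf
      ≡⟨ solve 5 (λ a b c d e → a :+ b :+ c :+ d :+ e := b :+ e :+ (a :+ c :+ d)) refl vx cv fK (length K) cf ⟩
    cv + cf + (vx + fK + length K)
      ≤⟨ ℕₚ.+-monoˡ-≤ (vx + fK + length K) (cost≤1 {x} {A} {K ++ H} others) ⟩
    suc (vx + fK + length K)          ≡⟨ sym (ℕₚ.+-suc (vx + fK) (length K)) ⟩
    vx + fK + suc (length K)          ∎
    where
    open ℕₚ.≤-Reasoning
    open +-*-Solver
    vH = size (V.quotient H)
    fx = size (F.quotient (x ∷ A))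
    cf = F.cost {F.quotient A} {x} (F.joined? (F.quotient A) x)
    cv = V.cost {V.quotient (K ++ H)} {x} (V.joined? (V.quotient (K ++ H)) x)
    vx = size (V.quotient (x ∷ K ++ H))
    fK = size (F.quotient (K ʳ++ (x ∷ A)))
    all′ : ∀ j → j ∈ x ∷ A ⊎ j ∈ K ++ H
    all′ j with all j
    ... | inj₁ j∈A           = inj₁ (there j∈A)
    ... | inj₂ (here j≡x)    = inj₁ (here j≡x)
    ... | inj₂ (there j∈K++H) = inj₂ j∈K++H
    others : ∀ j → j ≡ x ⊎ j ∈ A ⊎ j ∈ K ++ H
    others j with all j
    ... | inj₁ j∈A           = inj₂ (inj₁ j∈A)
    ... | inj₂ (here j≡x)    = inj₁ j≡x
    ... | inj₂ (there j∈K++H) = inj₂ (inj₂ j∈K++H)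

  -- Euler's inequality for the subgraph with edges `H`. Here `q` bounds the vertex merges along `H`
  -- and `p` the face merges along `H` after those along `K`; `exchange` accounts for `K`.
  edges-bound : ∀ {e c p q} K H →
    (∀ j → j ∈ K ++ H) → v + f ≡ e + 2 * c → e ≡ length K + length H →
    size (V.quotient (K ++ H)) ≤ c → size (F.quotient (H ʳ++ (K ʳ++ []))) ≤ c →
    v ≤ size (V.quotient H) + q → size (F.quotient (K ʳ++ [])) ≤ size (F.quotient (H ʳ++ (K ʳ++ []))) + p →
    length H ≤ p + q
  edges-bound {e} {c} {p} {q} K H all euler e≡ v≤c f≤c v≤ f≤ = ℕₚ.+-cancelʳ-≤ (length K + 2 * c) _ _ (begin
    length H + (length K + 2 * c)     ≡⟨ solve 3 (λ a b c → a :+ (b :+ c) := b :+ a :+ c) refl (length H) (length K) (2 * c) ⟩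
    length K + length H + 2 * c       ≡⟨ sym (trans euler (cong (_+ 2 * c) e≡)) ⟩
    v + f                             ≤⟨ ℕₚ.+-monoˡ-≤ f v≤ ⟩
    size (V.quotient H) + q + f       ≡⟨ solve 3 (λ a b c → a :+ b :+ c := a :+ c :+ b) refl (size (V.quotient H)) q f ⟩
    size (V.quotient H) + f + q       ≤⟨ ℕₚ.+-monoˡ-≤ q (exchange K H [] (inj₂ ∘ all)) ⟩
    size (V.quotient (K ++ H)) + size (F.quotient (K ʳ++ [])) + length K + q
      ≤⟨ ℕₚ.+-monoˡ-≤ q (ℕₚ.+-monoˡ-≤ (length K) (ℕₚ.+-mono-≤ v≤c (ℕₚ.≤-trans f≤ (ℕₚ.+-monoˡ-≤ p f≤c)))) ⟩
    c + (c + p) + length K + q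
      ≡⟨ solve 4 (λ c p k q → c :+ (c :+ p) :+ k :+ q := p :+ q :+ (k :+ con 2 :* c)) refl c p (length K) q ⟩
    p + q + (length K + 2 * c)        ∎)
    where
    open ℕₚ.≤-Reasoning
    open +-*-Solver

-- Rotation systems of genus 0

open import Algebra.Properties.CommutativeMonoid.Sum
  (CommutativeRing.+-commutativeMonoid Boolₚ.xor-∧-commutativeRing) as ⨁
  using () renaming (sum to ⨁)

⨁-split : ∀ m {n} (f : Fin (m + n) → Bool) → ⨁ f ≡ ⨁ (f ∘ (_↑ˡ n)) xor ⨁ (f ∘ (m ↑ʳ_))
⨁-split zero    f = refl
⨁-split (suc m) f = trans (cong (f zero xor_) (⨁-split m (f ∘ suc))) (sym (Boolₚ.xor-assoc (f zero) _ _))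

⨁-false : ∀ {m} (f : Fin m → Bool) → (∀ i → f i ≡ false) → ⨁ f ≡ false
⨁-false {zero}  f f≡ = refl
⨁-false {suc m} f f≡ = cong₂ _xor_ (f≡ zero) (⨁-false (f ∘ suc) (f≡ ∘ suc))

⨁-only : ∀ {m} (f : Fin m → Bool) i → f i ≡ true → (∀ j → j ≢ i → f j ≡ false) → ⨁ f ≡ true
⨁-only f zero    fi f≡ = cong₂ _xor_ fi (⨁-false (f ∘ suc) λ j → f≡ (suc j) λ ())
⨁-only f (suc i) fi f≡ = cong₂ _xor_ (f≡ zero λ ())
  (⨁-only (f ∘ suc) i fi λ j j≢i → f≡ (suc j) (j≢i ∘ Finₚ.suc-injective))

EqClosure⇒≡ : ∀ {A B : Set} {R : A → A → Set} (h : A → B) → (∀ {x y} → R x y → h x ≡ h y) →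
              ∀ {x y} → EqClosure R x y → h x ≡ h y
EqClosure⇒≡ h resp = Eq.gfold isEquivalence h resp

module Darts {n} {G : Graph n} where

  open Graph G using (adj; symmetric; loopless)

  dart-≡ : ∀ {d e : Dart G} → src d ≡ src e → tgt d ≡ tgt e → d ≡ e
  dart-≡ {dart u v p} {dart _ _ q} refl refl = cong (dart u v) (Boolₚ.T-irrelevant p q)

  _≟ᵈ_ : (d e : Dart G) → Dec (d ≡ e)
  d ≟ᵈ e = map′ (λ (p , q) → dart-≡ p q) (λ { refl → refl , refl })
                ((src d Fin.≟ src e) ×-dec (tgt d Fin.≟ tgt e))

  rev-involutive : ∀ (d : Dart G) → rev (rev d) ≡ d
  rev-involutive d = dart-≡ refl refl

  rev-≢ : ∀ (d : Dart G) → d ≢ rev d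
  rev-≢ d e = true≢false (T⇒true (Dart.edge d)) (trans (cong (adj (src d)) (sym (cong src e))) (loopless (src d)))

  -- As `rev` is an involution, the relation on the right is already an equivalence.
  EqClosure-rev : ∀ {d e : Dart G} → EqClosure (Step rev) d e → d ≡ e ⊎ rev d ≡ e
  EqClosure-rev = Eq.fold isEquiv inj₂
    where
    isEquiv : IsEquivalence (λ (d e : Dart G) → d ≡ e ⊎ rev d ≡ e)
    isEquiv = record
      { refl  = inj₁ refl
      ; sym   = λ { (inj₁ p) → inj₁ (sym p)
                  ; (inj₂ p) → inj₂ (trans (cong rev (sym p)) (rev-involutive _)) }
      ; trans = λ { (inj₁ refl) q → q
                  ; (inj₂ p) (inj₁ refl) → inj₂ p
                  ; {d} (inj₂ refl) (inj₂ q) → inj₁ (trans (sym (rev-involutive d)) q) }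
      }

module Genus0 {n} {G : Graph n} (R : RotationSystem G) (genus : HasGenus R 0) where

  open Graph G using (adj; symmetric; loopless)
  open RotationSystem R
  open HasGenus genus
  open Darts {G = G}

  D : Set
  D = Dart G

  vertex : D → Fin v
  vertex = Bijection.to vertices

  edge : D → Fin e
  edge = Bijection.to edges

  face : D → Fin f
  face = Bijection.to faces

  component : D → Fin c
  component = Bijection.to components

  vertex-next : ∀ d → vertex (next d) ≡ vertex d
  vertex-next d = sym (Bijection.cong vertices (Eq.return refl))

  vertex-src : ∀ {d d′} → src d ≡ src d′ → vertex d ≡ vertex d′
  vertex-src p = Bijection.cong vertices (Equivalence.from (orbits _ _) p)

  -- `next d` is the successor of `rev d` on its face.
  face-next : ∀ d → face (next d) ≡ face (rev d)
  face-next d = trans (cong (face ∘ next) (sym (rev-involutive d))) (sym (Bijection.cong faces (Eq.return refl)))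

  edge-rev : ∀ d → edge (rev d) ≡ edge d
  edge-rev d = sym (Bijection.cong edges (Eq.return refl))

  rep : Fin e → D
  rep i = proj₁ (Bijection.surjective edges i)

  edge-rep : ∀ i → edge (rep i) ≡ i
  edge-rep i = proj₂ (Bijection.surjective edges i) ε

  edge-cases : ∀ d → rep (edge d) ≡ d ⊎ rev (rep (edge d)) ≡ d
  edge-cases d = EqClosure-rev (Bijection.injective edges (edge-rep (edge d)))

  side : Fin e ⊎ Fin e → D
  side = [ rep , rev ∘ rep ]′

  unside : D → Fin e ⊎ Fin e
  unside d with rep (edge d) ≟ᵈ d
  ... | yes _ = inj₁ (edge d)
  ... | no  _ = inj₂ (edge d)

  side-unside : ∀ d → side (unside d) ≡ d
  side-unside d with rep (edge d) ≟ᵈ d | edge-cases d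
  ... | yes p | _      = p
  ... | no ¬p | inj₁ p = contradiction p ¬p
  ... | no _  | inj₂ p = p

  unside-side : ∀ x → unside (side x) ≡ x
  unside-side (inj₁ i) with rep (edge (rep i)) ≟ᵈ rep i
  ... | yes _ = cong inj₁ (edge-rep i)
  ... | no ¬p = contradiction (cong rep (edge-rep i)) ¬p
  unside-side (inj₂ i) with rep (edge (rev (rep i))) ≟ᵈ rev (rep i)
  ... | yes p = contradiction (trans (cong rep (sym (trans (edge-rev (rep i)) (edge-rep i)))) p) (rev-≢ (rep i))
  ... | no  _ = cong inj₂ (trans (edge-rev (rep i)) (edge-rep i))

  -- Two darts per edge. This makes the darts an explicit finite set, over which one can sum and
  -- apply the pigeonhole principle.
  sides : Fin (e + e) ↔ D
  sides = mk↔ₛ′ (side ∘ splitAt e) (Fin.join e e ∘ unside)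
    (λ d → trans (cong side (Finₚ.splitAt-join e e (unside d))) (side-unside d))
    (λ i → trans (cong (Fin.join e e) (unside-side (splitAt e i))) (Finₚ.join-splitAt e e i))

  face-step : D ↔ D
  face-step = mk↔ₛ′ (next ∘ rev) (rev ∘ Inverse.from rot)
    (λ d → trans (cong next (rev-involutive _)) (Inverse.strictlyInverseˡ rot d))
    (λ d → trans (cong rev (Inverse.strictlyInverseʳ rot (rev d))) (rev-involutive d))

  ⨁ᵈ : (D → Bool) → Bool
  ⨁ᵈ h = ⨁ (h ∘ Inverse.to sides)

  ⨁ᵈ-face-step : ∀ h → ⨁ᵈ h ≡ ⨁ᵈ (h ∘ next ∘ rev)
  ⨁ᵈ-face-step h = trans (⨁.sum-permute (h ∘ to) (↔-sym sides ↔-∘ (face-step ↔-∘ sides)))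
    (⨁.sum-cong-≗ (λ i → cong h (Inverse.strictlyInverseˡ sides (next (rev (to i))))))
    where to = Inverse.to sides

  ⨁ᵈ-edges : ∀ h → ⨁ᵈ h ≡ ⨁ (λ i → h (rep i) xor h (rev (rep i)))
  ⨁ᵈ-edges h = trans (⨁-split e (h ∘ Inverse.to sides)) (trans (cong₂ _xor_
    (⨁.sum-cong-≗ (λ i → cong (h ∘ side) (Finₚ.splitAt-↑ˡ e i e)))
    (⨁.sum-cong-≗ (λ i → cong (h ∘ side) (Finₚ.splitAt-↑ʳ e e i))))
    (sym (⨁.∑-distrib-+ (h ∘ rep) (h ∘ rev ∘ rep))))

  vs vt : Fin e → Fin v
  vs = vertex ∘ rep
  vt = vertex ∘ rev ∘ rep

  fs ft : Fin e → Fin f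
  fs = face ∘ rep
  ft = face ∘ rev ∘ rep

  -- This is `(a xor b) ∧ (x xor y)`, which is 1 when the edge lies in both cuts, multiplied out and
  -- grouped so that its sum over edges becomes two sums over darts.
  crossing : (a b x y : Bool) → Bool
  crossing a b x y = ((a ∧ x) xor (b ∧ y)) xor ((a ∧ y) xor (b ∧ x))

  crossing-≡ˡ : ∀ {a b} x y → a ≡ b → crossing a b x y ≡ false
  crossing-≡ˡ {true}  true  true  refl = refl
  crossing-≡ˡ {true}  true  false refl = refl
  crossing-≡ˡ {true}  false true  refl = refl
  crossing-≡ˡ {true}  false false refl = refl
  crossing-≡ˡ {false} _     _     refl = refl

  crossing-≡ʳ : ∀ a b {x y} → x ≡ y → crossing a b x y ≡ false
  crossing-≡ʳ a b {x} refl = Boolₚ.xor-same ((a ∧ x) xor (b ∧ x))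

  crossing-≢ : ∀ {a b x y} → a ≢ b → x ≢ y → crossing a b x y ≡ true
  crossing-≢ {true}  {true}  a≢b _ = contradiction refl a≢b
  crossing-≢ {false} {false} a≢b _ = contradiction refl a≢b
  crossing-≢ {true}  {false} {true}  {true}  _ x≢y = contradiction refl x≢y
  crossing-≢ {true}  {false} {false} {false} _ x≢y = contradiction refl x≢y
  crossing-≢ {true}  {false} {true}  {false} _ _ = refl
  crossing-≢ {true}  {false} {false} {true}  _ _ = refl
  crossing-≢ {false} {true}  {true}  {true}  _ x≢y = contradiction refl x≢y
  crossing-≢ {false} {true}  {false} {false} _ x≢y = contradiction refl x≢y
  crossing-≢ {false} {true}  {true}  {false} _ _ = refl
  crossing-≢ {false} {true}  {false} {true}  _ _ = refl

  -- Walking along a face changes sides of a vertex cut an even number of times, so the dual of a cut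
  -- is an even graph and meets every cut of the dual in an even number of edges.
  cut-parity : ∀ (C : Fin f → Bool) (X : Fin v → Bool) →
               ⨁ (λ i → crossing (C (fs i)) (C (ft i)) (X (vs i)) (X (vt i))) ≡ false
  cut-parity C X = begin
    ⨁ (λ i → crossing (C (fs i)) (C (ft i)) (X (vs i)) (X (vt i)))
      ≡⟨ ⨁.∑-distrib-+ {e} (λ i → (C (fs i) ∧ X (vs i)) xor (C (ft i) ∧ X (vt i)))
                           (λ i → (C (fs i) ∧ X (vt i)) xor (C (ft i) ∧ X (vs i))) ⟩
    ⨁ (λ i → (C (fs i) ∧ X (vs i)) xor (C (ft i) ∧ X (vt i))) xor
    ⨁ (λ i → (C (fs i) ∧ X (vt i)) xor (C (ft i) ∧ X (vs i)))
      ≡⟨ cong₂ _xor_ (sym (⨁ᵈ-edges h₁)) (trans (⨁.sum-cong-≗ twice) (sym (⨁ᵈ-edges h₂))) ⟩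
    ⨁ᵈ h₁ xor ⨁ᵈ h₂
      ≡⟨ cong (_xor ⨁ᵈ h₂) (trans (⨁ᵈ-face-step h₁) (⨁.sum-cong-≗ (moved ∘ Inverse.to sides))) ⟩
    ⨁ᵈ h₂ xor ⨁ᵈ h₂
      ≡⟨ Boolₚ.xor-same (⨁ᵈ h₂) ⟩
    false
      ∎
    where
    open ≡-Reasoning
    h₁ h₂ : D → Bool
    h₁ d = C (face d) ∧ X (vertex d)
    h₂ d = C (face d) ∧ X (vertex (rev d))
    twice : ∀ i → (C (fs i) ∧ X (vt i)) xor (C (ft i) ∧ X (vs i)) ≡ h₂ (rep i) xor h₂ (rev (rep i))
    twice i = cong (λ d → (C (fs i) ∧ X (vt i)) xor (C (ft i) ∧ X (vertex d))) (sym (rev-involutive (rep i)))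
    -- The successor of `d` along its face stays on the face and starts where `d` ends.
    moved : ∀ d → h₁ (next (rev d)) ≡ h₂ d
    moved d = cong₂ (λ a b → C a ∧ X b)
      (trans (face-next (rev d)) (cong face (rev-involutive d))) (vertex-next (rev d))

  -- If `i` were the only common edge of the two cuts, the sum in `cut-parity` would be 1.
  orthogonal : ∀ (C : Fin f → Bool) (X : Fin v → Bool) i → C (fs i) ≢ C (ft i) → X (vs i) ≢ X (vt i) →
               ¬ (∀ j → j ≡ i ⊎ C (fs j) ≡ C (ft j) ⊎ X (vs j) ≡ X (vt j))
  orthogonal C X i Ci Xi others = true≢false (⨁-only {e} _ i (crossing-≢ Ci Xi) even) (cut-parity C X)
    where
    even : ∀ j → j ≢ i → crossing (C (fs j)) (C (ft j)) (X (vs j)) (X (vt j)) ≡ false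
    even j j≢i with others j
    ... | inj₁ j≡i      = contradiction j≡i j≢i
    ... | inj₂ (inj₁ p) = crossing-≡ˡ (X (vs j)) (X (vt j)) p
    ... | inj₂ (inj₂ p) = crossing-≡ʳ (C (fs j)) (C (ft j)) p

  -- A map constant on components factors through them, and `pick` shows that it is onto.
  classes≤components : ∀ {m} (h : D → Fin m) (pick : Fin m → D) → (∀ y → h (pick y) ≡ y) →
                       (∀ d → h (next d) ≡ h d) → (∀ d → h (rev d) ≡ h d) → m ≤ c
  classes≤components h pick h-pick h-next h-rev = Finₚ.injective⇒≤ {f = component ∘ pick} λ {x} {y} eq →
    trans (sym (h-pick x)) (trans (EqClosure⇒≡ h respects (Bijection.injective components eq)) (h-pick y))
    where
    respects : ∀ {x y} → _ → h x ≡ h y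
    respects (inj₁ refl) = sym (h-next _)
    respects (inj₂ refl) = sym (h-rev _)

-- Non-backtracking walks

module _ {n} (G : Graph n) where

  open Graph G using (adj; symmetric; loopless)

  record NonBacktracking (p : ℕ → Fin n) : Set where
    field
      adjacent : ∀ i → adj (p i) (p (suc i)) ≡ true
      turns    : ∀ i → p (suc (suc i)) ≢ p i

  -- A repetition inside the closed walk gives a shorter closed walk, with `m` bounding the
  -- recursion. Without one the walk is a cycle: length 1 would be a loop and length 2 a backtrack.
  closed⇒cycle : ∀ {p} → NonBacktracking p → ∀ m k i → k < m → p i ≡ p (i + suc k) →
                 ∃[ l ] l ≤ suc k × Cycle G l
  closed⇒cycle {p} nb (suc m) k i (s≤s k≤m) pᵢ≡
    with Finₚ.any? {suc k} (λ a → Finₚ.any? {suc k} (λ b →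
           (toℕ a ℕₚ.<? toℕ b) ×-dec (p (i + toℕ a) Fin.≟ p (i + toℕ b))))
  ... | yes (a , b , a<b , eq) =
    let k′ = toℕ b ∸ suc (toℕ a)
        b≡ : toℕ a + suc k′ ≡ toℕ b
        b≡ = trans (ℕₚ.+-suc (toℕ a) k′) (ℕₚ.m+[n∸m]≡n a<b)
        k′<k : k′ < k
        k′<k = ℕₚ.<-≤-trans (subst (suc k′ ≤_) b≡ (ℕₚ.m≤n+m (suc k′) (toℕ a))) (ℕₚ.≤-pred (Finₚ.toℕ<n b))
        l , l≤ , cycle = closed⇒cycle nb m k′ (i + toℕ a) (ℕₚ.<-≤-trans k′<k k≤m)
          (trans eq (cong p (trans (cong (i +_) (sym b≡)) (sym (ℕₚ.+-assoc i (toℕ a) (suc k′))))))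
    in l , ℕₚ.≤-trans l≤ (ℕₚ.≤-trans k′<k (ℕₚ.n≤1+n k)) , cycle
  ... | no distinct = suc k , ℕₚ.≤-refl , record
    { 3≤length = long k pᵢ≡
    ; vertex   = λ a → p (i + toℕ a)
    ; distinct = inj
    ; steps    = λ a b b≡ → true⇒T (trans (cong (λ x → adj (p (i + toℕ a)) (p x))
        (trans (cong (i +_) b≡) (ℕₚ.+-suc i (toℕ a)))) (adjacent (i + toℕ a)))
    ; closing  = λ a b a≡ b≡ → true⇒T (trans (cong (adj (p (i + toℕ a)))
        (trans (cong p (trans (cong (i +_) b≡) (ℕₚ.+-identityʳ i)))
          (trans pᵢ≡ (cong p (trans (cong (i +_) (sym a≡)) (ℕₚ.+-suc i (toℕ a)))))))
        (adjacent (i + toℕ a)))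
    }
    where
    open NonBacktracking nb
    inj : Injective _≡_ _≡_ (λ (a : Fin (suc k)) → p (i + toℕ a))
    inj {a} {b} eq with ℕₚ.<-cmp (toℕ a) (toℕ b)
    ... | tri< a<b _ _ = contradiction (a , b , a<b , eq) distinct
    ... | tri≈ _ a≡b _ = Finₚ.toℕ-injective a≡b
    ... | tri> _ _ b<a = contradiction (b , a , b<a , sym eq) distinct
    long : ∀ k → p i ≡ p (i + suc k) → 3 ≤ suc k
    long 0 eq = ⊥-elim (true≢false (adjacent i)
      (trans (cong (adj (p i)) (trans (cong p (sym (ℕₚ.+-comm i 1))) (sym eq))) (loopless (p i))))
    long 1 eq = ⊥-elim (turns i (sym (trans eq (cong p (ℕₚ.+-comm i 2)))))
    long (suc (suc k)) _ = s≤s (s≤s (s≤s z≤n))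

  girth⇒≢ : ∀ {g p} → (∀ k → Cycle G k → g ≤ k) → NonBacktracking p →
            ∀ (a b : Fin g) → toℕ a < toℕ b → p (toℕ a) ≢ p (toℕ b)
  girth⇒≢ {p = p} girth nb a b a<b eq =
    let k = toℕ b ∸ suc (toℕ a)
        b≡ : toℕ a + suc k ≡ toℕ b
        b≡ = trans (ℕₚ.+-suc (toℕ a) k) (ℕₚ.m+[n∸m]≡n a<b)
        l , l≤ , cycle = closed⇒cycle nb (suc k) k (toℕ a) ℕₚ.≤-refl (trans eq (cong p (sym b≡)))
    in ℕₚ.<⇒≱ (Finₚ.toℕ<n b) (ℕₚ.≤-trans (girth l cycle)
         (ℕₚ.≤-trans l≤ (subst (_≤ toℕ b) (ℕₚ.+-∸-assoc 1 a<b) (ℕₚ.m∸n≤m (toℕ b) (toℕ a)))))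

  girth⇒distinct : ∀ {g p} → (∀ k → Cycle G k → g ≤ k) → NonBacktracking p →
                   ∀ {a b : Fin g} → p (toℕ a) ≡ p (toℕ b) → a ≡ b
  girth⇒distinct girth nb {a} {b} eq with ℕₚ.<-cmp (toℕ a) (toℕ b)
  ... | tri< a<b _ _ = contradiction eq (girth⇒≢ girth nb a b a<b)
  ... | tri≈ _ a≡b _ = Finₚ.toℕ-injective a≡b
  ... | tri> _ _ b<a = contradiction (sym eq) (girth⇒≢ girth nb b a b<a)

-- Orbits of a permutation of a finite set

module _ {A : Set} (σ : A ↔ A) where

  open Inverse σ using (to; from)

  iterate : ℕ → A → A
  iterate zero    x = x
  iterate (suc m) x = iterate m (to x)

  iterate-+ : ∀ a b x → iterate (a + b) x ≡ iterate b (iterate a x)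
  iterate-+ zero    b x = refl
  iterate-+ (suc a) b x = iterate-+ a b (to x)

  to-injective : ∀ {x y} → to x ≡ to y → x ≡ y
  to-injective {x} {y} eq = trans (sym (Inverse.strictlyInverseʳ σ x))
    (trans (cong from eq) (Inverse.strictlyInverseʳ σ y))

  iterate-injective : ∀ m {x y} → iterate m x ≡ iterate m y → x ≡ y
  iterate-injective zero    eq = eq
  iterate-injective (suc m) eq = to-injective (iterate-injective m eq)

  -- Two of the first `k + 1` iterates coincide, and injectivity cancels the earlier one.
  period : ∀ {k} → Fin k ↔ A → ∀ x → ∃[ p ] iterate (suc p) x ≡ x
  period {k} A-finite x
    with Finₚ.pigeonhole {k} {suc k} ℕₚ.≤-refl (λ i → Inverse.from A-finite (iterate (toℕ i) x))
  ... | i , j , i<j , eq = p , iterate-injective (toℕ i)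
    (trans (sym (iterate-+ (suc p) (toℕ i) x)) (trans (cong (λ m → iterate m x) j≡) (sym same)))
    where
    p = toℕ j ∸ suc (toℕ i)
    j≡ : suc p + toℕ i ≡ toℕ j
    j≡ = trans (ℕₚ.+-comm (suc p) (toℕ i)) (trans (ℕₚ.+-suc (toℕ i) p) (ℕₚ.m+[n∸m]≡n i<j))
    same : iterate (toℕ i) x ≡ iterate (toℕ j) x
    same = trans (sym (Inverse.strictlyInverseˡ A-finite _))
      (trans (cong (Inverse.to A-finite) eq) (Inverse.strictlyInverseˡ A-finite _))

  -- A backward step amounts to going forward through the rest of a period.
  EqClosure⇒iterate : ∀ {k} → Fin k ↔ A → ∀ {x y} → EqClosure (Step to) x y → ∃[ m ] iterate m x ≡ y
  EqClosure⇒iterate A-finite ε = 0 , refl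
  EqClosure⇒iterate A-finite (fwd refl ◅ rest) with EqClosure⇒iterate A-finite rest
  ... | m , eq = suc m , eq
  EqClosure⇒iterate A-finite (_◅_ {j = y} (bwd refl) rest) with EqClosure⇒iterate A-finite rest | period A-finite y
  ... | m , eq | p , back = p + m , trans (iterate-+ p m _) (trans (cong (iterate m) back) eq)

-- Sparsity of induced subgraphs

∈-ʳ++⁺ : ∀ {A : Set} {x : A} L {M} → x ∈ L ⊎ x ∈ M → x ∈ L ʳ++ M
∈-ʳ++⁺ []      (inj₂ x∈M)         = x∈M
∈-ʳ++⁺ (y ∷ L) (inj₁ (here x≡y))  = ∈-ʳ++⁺ L (inj₂ (here x≡y))
∈-ʳ++⁺ (y ∷ L) (inj₁ (there x∈L)) = ∈-ʳ++⁺ L (inj₁ x∈L)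
∈-ʳ++⁺ (y ∷ L) (inj₂ x∈M)         = ∈-ʳ++⁺ L (inj₂ (there x∈M))

count-true : ∀ n → count {n} (λ _ → true) ≡ n
count-true zero    = refl
count-true (suc n) = cong suc (count-true n)

2≤count⇒another : ∀ {n} (P : Fin n → Bool) → 2 ≤ count P → ∀ u → ∃[ z ] P z ≡ true × z ≢ u
2≤count⇒another P 2≤ u
  with members P | length-members P | members-unique P | (λ {x} → ∈-members⁻ P {x})
... | []          | eq | _ | _ = contradiction (subst (2 ≤_) (sym eq) 2≤) λ ()
... | _ ∷ []      | eq | _ | _ = contradiction (subst (2 ≤_) (sym eq) 2≤) λ { (s≤s ()) }
... | p ∷ q ∷ _   | _  | (p≢q ∷ _) ∷ _ | ⁻ with p Fin.≟ u
...   | no p≢u   = p , ⁻ (here refl) , p≢u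
...   | yes refl = q , ⁻ (there (here refl)) , p≢q ∘ sym

length-concat-tabulate : ∀ {A : Set} {n} (f : Fin n → List A) → length (concat (tabulate f)) ≡ ∑ (length ∘ f)
length-concat-tabulate {n = zero}  f = refl
length-concat-tabulate {n = suc n} f =
  trans (Listₚ.length-++ (f zero)) (cong (length (f zero) +_) (length-concat-tabulate (f ∘ suc)))

∑-pairs≤ : ∀ {n} (r : Fin n → Fin n → Bool) (Y : List (Fin n × Fin n)) →
           (∀ {u v} → r u v ≡ true → (u , v) ∈ Y) → ∑ (λ u → count (r u)) ≤ length Y
∑-pairs≤ {n} r Y r⊆Y = subst (_≤ length Y) pairs
  (unique⊆⇒length≤ (Uniqueₚ.concat⁺ (Allₚ.tabulate⁺ row-unique) (AllPairsₚ.tabulate⁺ rows-disjoint)) ⊆Y)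
  where
  row : Fin n → List (Fin n × Fin n)
  row u = map (u ,_) (members (r u))
  pairs : length (concat (tabulate row)) ≡ ∑ (λ u → count (r u))
  pairs = trans (length-concat-tabulate row)
    (∑-cong λ u → trans (Listₚ.length-map (u ,_) (members (r u))) (length-members (r u)))
  row-unique : ∀ u → Unique (row u)
  row-unique u = Uniqueₚ.map⁺ (cong proj₂) (members-unique (r u))
  rows-disjoint : ∀ {u u′} → u ≢ u′ → ∀ {x} → ¬ (x ∈ row u × x ∈ row u′)
  rows-disjoint u≢u′ (p , q) with ∈ₚ.∈-map⁻ _ p | ∈ₚ.∈-map⁻ _ q
  ... | _ , _ , refl | _ , _ , eq = u≢u′ (cong proj₁ eq)
  ⊆Y : ∀ {x} → x ∈ concat (tabulate row) → x ∈ Y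
  ⊆Y x∈ with ∈ₚ.∈-concat⁻′ (tabulate row) x∈
  ... | _ , x∈row , row∈ with ∈ₚ.∈-tabulate⁻ row∈
  ...   | u , refl with ∈ₚ.∈-map⁻ _ x∈row
  ...     | v , v∈ , refl = r⊆Y (∈-members⁻ (r u) v∈)

module _ {n} {G : Graph n} (R : RotationSystem G) (genus : HasGenus R 0)
         {g : ℕ} (girth : ∀ k → Cycle G k → g ≤ k)
         (S : Fin n → Bool) (2≤deg : ∀ {u} → S u ≡ true → 2 ≤ deg G S u) where

  open Graph G using (adj; symmetric; loopless)
  open RotationSystem R
  open HasGenus genus
  open Darts {G = G}
  open Genus0 R genus
  module O = Orthogonal vs vt fs ft orthogonal
  open O using (module V; module F)

  inside : D → Bool
  inside d = S (src d) ∧ S (tgt d)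

  inside-rev : ∀ d → inside (rev d) ≡ inside d
  inside-rev d = Boolₚ.∧-comm (S (tgt d)) (S (src d))

  insideEdge : Fin e → Bool
  insideEdge = inside ∘ rep

  -- `K` holds the edges outside the induced subgraph and `H` those inside. `H` is reversed so that
  -- its quotient is the left fold of merges along `L`.
  K L H : List (Fin e)
  K = members (not ∘ insideEdge)
  L = members insideEdge
  H = reverse L

  ∈H : ∀ {i} → insideEdge i ≡ true → i ∈ H
  ∈H ins = ∈-ʳ++⁺ L (inj₁ (∈-members⁺ insideEdge ins))

  K∪H : ∀ i → i ∈ K ++ H
  K∪H i with dichotomy (insideEdge i)
  ... | inj₁ ins = ∈ₚ.∈-++⁺ʳ K (∈H ins)
  ... | inj₂ out = ∈ₚ.∈-++⁺ˡ (∈-members⁺ (not ∘ insideEdge) (cong not out))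

  e≡K+H : e ≡ length K + length H
  e≡K+H = trans (sym (count-true e)) (trans (count-split (λ _ → true) insideEdge)
    (sym (cong₂ _+_ (length-members (not ∘ insideEdge))
                    (trans (Listₚ.length-reverse L) (length-members insideEdge)))))

  rev-invariant : ∀ {A : Set} (h : D → A) d → h (rep (edge d)) ≡ h (rev (rep (edge d))) → h (rev d) ≡ h d
  rev-invariant h d eq with edge-cases d
  ... | inj₁ p = trans (cong (h ∘ rev) (sym p)) (trans (sym eq) (cong h p))
  ... | inj₂ p = trans (cong (h ∘ rev) (sym p))
    (trans (cong h (rev-involutive (rep (edge d)))) (trans eq (cong h p)))

  vertexClasses≤ : size (V.quotient (K ++ H)) ≤ c
  vertexClasses≤ = classes≤components (class Q ∘ vertex) (proj₁ ∘ Bijection.surjective vertices ∘ member Q)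
    (λ y → trans (cong (class Q) (proj₂ (Bijection.surjective vertices (member Q y)) ε)) (section Q y))
    (λ d → cong (class Q) (vertex-next d))
    (λ d → rev-invariant (class Q ∘ vertex) d (V.∈⇒joined (K∪H (edge d))))
    where Q = V.quotient (K ++ H)

  K′ : List (Fin e)
  K′ = reverse K

  faceClasses≤ : size (F.quotient (H ʳ++ K′)) ≤ c
  faceClasses≤ = classes≤components (class Q ∘ face) (proj₁ ∘ Bijection.surjective faces ∘ member Q)
    (λ y → trans (cong (class Q) (proj₂ (Bijection.surjective faces (member Q y)) ε)) (section Q y))
    (λ d → trans (cong (class Q) (face-next d)) (invariant d))
    invariant
    where
    Q = F.quotient (H ʳ++ K′)
    all : ∀ i → i ∈ H ʳ++ K′
    all i with ∈ₚ.∈-++⁻ K (K∪H i)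
    ... | inj₁ i∈K = ∈-ʳ++⁺ H (inj₂ (∈-ʳ++⁺ K (inj₁ i∈K)))
    ... | inj₂ i∈H = ∈-ʳ++⁺ H (inj₁ i∈H)
    invariant : ∀ d → class Q (face (rev d)) ≡ class Q (face d)
    invariant d = rev-invariant (class Q ∘ face) d (F.∈⇒joined (all (edge d)))

  -- The faces of the subgraph induced by S, up to components of G that avoid it.
  region : D → Fin (size (F.quotient K′))
  region = class (F.quotient K′) ∘ face

  region-next : ∀ d → region (next d) ≡ region (rev d)
  region-next d = cong (class (F.quotient K′)) (face-next d)

  inside-edge : ∀ d → insideEdge (edge d) ≡ inside d
  inside-edge d with edge-cases d
  ... | inj₁ p = cong inside p
  ... | inj₂ p = trans (sym (inside-rev (rep (edge d)))) (cong inside p)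

  region-rev : ∀ d → inside d ≡ false → region (rev d) ≡ region d
  region-rev d out = rev-invariant region d (F.∈⇒joined (∈-ʳ++⁺ K (inj₁
    (∈-members⁺ (not ∘ insideEdge) (cong not (trans (inside-edge d) out))))))

  -- Boundary walks of regions

  src-next : ∀ d → src (next d) ≡ src d
  src-next d = sym (Equivalence.to (orbits d (next d)) (Eq.return refl))

  Continues : D → D → Set
  Continues d d′ = inside d′ ≡ true × src d′ ≡ tgt d × tgt d′ ≢ src d × region d′ ≡ region d

  abstract
    -- Rotating about the end of `d`, starting after `rev d`, outside darts are skipped: the faces
    -- on their two sides belong to one region. The search stops at the latest at a second neighbour
    -- `z` in `S`, which exists as degrees are at least 2.
    continue : ∀ d → inside d ≡ true → ∃ (Continues d)
    continue d ins with 2≤count⇒another (nbr G S (tgt d)) (2≤deg (∧-trueʳ {S (src d)} ins)) (src d)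
    ... | z , wz , z≢ with EqClosure⇒iterate rot sides
                             (Equivalence.from (orbits (rev d) (dart (tgt d) z (true⇒T (∧-trueʳ {S z} wz)))) refl)
    ...   | zero  , eq = contradiction (sym (cong tgt eq)) z≢
    ...   | suc m , eq = search m (next (rev d)) (trans (region-next (rev d)) (cong region (rev-involutive d)))
                           (src-next (rev d)) eq
      where
      target : D
      target = dart (tgt d) z (true⇒T (∧-trueʳ {S z} wz))
      search : ∀ m y → region y ≡ region d → src y ≡ tgt d → iterate rot m y ≡ target → ∃ (Continues d)
      search zero    y ry sy refl = y , ∧-true (∧-trueʳ {S (src d)} ins) (∧-trueˡ wz) , refl , z≢ , ry
      search (suc m) y ry sy eq with dichotomy (inside y)
      ... | inj₂ out = search m (next y) (trans (region-next y) (trans (region-rev y out) ry))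
                              (trans (src-next y) sy) eq
      ... | inj₁ ins with tgt y Fin.≟ src d
      ...   | no ¬back = y , ins , sy , ¬back , ry
      -- The number of rotations may exceed a full turn. On coming back to `rev d`, the search
      -- starts over in the region of `d`.
      ...   | yes back = search m (next y) (trans (region-next y) (cong region (dart-≡ back sy)))
                              (trans (src-next y) sy) eq

  InsideDart : Set
  InsideDart = Σ D λ d → inside d ≡ true

  step : InsideDart → InsideDart
  step (d , i) = proj₁ (continue d i) , proj₁ (proj₂ (continue d i))

  step-src : ∀ w → src (proj₁ (step w)) ≡ tgt (proj₁ w)
  step-src (d , i) = proj₁ (proj₂ (proj₂ (continue d i)))

  step-tgt : ∀ w → tgt (proj₁ (step w)) ≢ src (proj₁ w)
  step-tgt (d , i) = proj₁ (proj₂ (proj₂ (proj₂ (continue d i))))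

  step-region : ∀ w → region (proj₁ (step w)) ≡ region (proj₁ w)
  step-region (d , i) = proj₂ (proj₂ (proj₂ (proj₂ (continue d i))))

  walk : InsideDart → ℕ → InsideDart
  walk w zero    = w
  walk w (suc m) = step (walk w m)

  walk-region : ∀ w m → region (proj₁ (walk w m)) ≡ region (proj₁ w)
  walk-region w zero    = refl
  walk-region w (suc m) = trans (step-region (walk w m)) (walk-region w m)

  walk-nonBacktracking : ∀ w → NonBacktracking G (src ∘ proj₁ ∘ walk w)
  walk-nonBacktracking w = record
    { adjacent = λ m → trans (cong (adj (src (proj₁ (walk w m)))) (step-src (walk w m)))
                             (T⇒true (Dart.edge (proj₁ (walk w m))))
    ; turns    = λ m eq → step-tgt (walk w m) (trans (sym (step-src (step (walk w m)))) eq)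
    }

  insideDarts : List D
  insideDarts = map rep H ++ map (rev ∘ rep) H

  length-insideDarts : length insideDarts ≡ length H + length H
  length-insideDarts = trans (Listₚ.length-++ (map rep H))
    (cong₂ _+_ (Listₚ.length-map rep H) (Listₚ.length-map (rev ∘ rep) H))

  ∈-insideDarts : ∀ {d} → inside d ≡ true → d ∈ insideDarts
  ∈-insideDarts {d} ins with edge-cases d
  ... | inj₁ p = ∈ₚ.∈-++⁺ˡ (subst (_∈ map rep H) p (∈ₚ.∈-map⁺ rep (∈H (trans (inside-edge d) ins))))
  ... | inj₂ p = ∈ₚ.∈-++⁺ʳ (map rep H)
    (subst (_∈ map (rev ∘ rep) H) p (∈ₚ.∈-map⁺ (rev ∘ rep) (∈H (trans (inside-edge d) ins))))

  Touches : Fin (size (F.quotient K′)) → Fin e → Set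
  Touches r i = insideEdge i ≡ true × (region (rep i) ≡ r ⊎ region (rev (rep i)) ≡ r)

  touches? : ∀ r i → Dec (Touches r i)
  touches? r i = (insideEdge i Boolₚ.≟ true) ×-dec ((region (rep i) Fin.≟ r) ⊎-dec (region (rev (rep i)) Fin.≟ r))

  -- Components of the graph that avoid `S` yield regions with no inside edge on their boundary;
  -- these are left out.
  touched : Fin (size (F.quotient K′)) → Bool
  touched r = does (Finₚ.any? (touches? r))

  regions : List (Fin (size (F.quotient K′)))
  regions = members touched

  start : ∀ r → touched r ≡ true → Σ InsideDart λ w → region (proj₁ w) ≡ r
  start r t with does⇒ (Finₚ.any? (touches? r)) t
  ... | i , ins , inj₁ p = (rep i , ins) , p
  ... | i , ins , inj₂ p = (rev (rep i) , trans (inside-rev (rep i)) ins) , p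

  -- The first `g` darts of a boundary walk in each region are all different: walks in different
  -- regions share no dart, and within one walk the sources are distinct by the girth.
  regions*girth≤ : length regions * g ≤ length H + length H
  regions*girth≤ = subst (length regions * g ≤_) length-insideDarts
    (injective∈⇒≤length dartOf inj (λ x → ∈-insideDarts (proj₂ (walk (proj₁ (begins (place x))) (toℕ (time x))))))
    where
    place : Fin (length regions * g) → Fin (length regions)
    place x = proj₁ (Fin.remQuot g x)
    time : Fin (length regions * g) → Fin g
    time x = proj₂ (Fin.remQuot {length regions} g x)
    begins : (l : Fin (length regions)) → Σ InsideDart λ w → region (proj₁ w) ≡ List.lookup regions l
    begins l = start _ (∈-members⁻ touched (∈ₚ.∈-lookup l))
    dartOf : Fin (length regions * g) → D
    dartOf x = proj₁ (walk (proj₁ (begins (place x))) (toℕ (time x)))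
    regionOf : ∀ x → region (dartOf x) ≡ List.lookup regions (place x)
    regionOf x = trans (walk-region (proj₁ (begins (place x))) (toℕ (time x))) (proj₂ (begins (place x)))
    inj : Injective _≡_ _≡_ dartOf
    inj {x} {y} eq = trans (sym (Finₚ.combine-remQuot {length regions} g x))
      (trans (cong₂ Fin.combine place≡ time≡) (Finₚ.combine-remQuot {length regions} g y))
      where
      place≡ : place x ≡ place y
      place≡ = lookup-injective (members-unique touched)
        (trans (sym (regionOf x)) (trans (cong region eq) (regionOf y)))
      time≡ : time x ≡ time y
      time≡ = girth⇒distinct G girth (walk-nonBacktracking (proj₁ (begins (place x))))
        (trans (cong src eq) (cong (λ l → src (proj₁ (walk (proj₁ (begins l)) (toℕ (time y))))) (sym place≡)))

  volume≤ : volume G S ≤ length H + length H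
  volume≤ = subst (volume G S ≤_) (trans (Listₚ.length-map ends insideDarts) length-insideDarts)
    (∑-pairs≤ (edgeIn G S) (map ends insideDarts) λ {u} {v} uv →
      ∈ₚ.∈-map⁺ ends (∈-insideDarts {dart u v (true⇒T (∧-trueʳ {S v} (∧-trueʳ {S u} uv)))}
        (∧-true (∧-trueˡ {S u} uv) (∧-trueˡ (∧-trueʳ {S u} uv)))))
    where
    ends : D → Fin n × Fin n
    ends d = src d , tgt d

  -- The vertex classes of the rotation system are classes of darts, so a vertex of `S` is reached
  -- there through a dart leaving it.
  dartAt : ∀ u → S u ≡ true → Σ D λ d → src d ≡ u
  dartAt u Su with 2≤count⇒another (nbr G S u) (2≤deg Su) u
  ... | z , uz , _ = dart u z (true⇒T (∧-trueʳ {S z} uz)) , refl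

  ∈L⇒inside : ∀ {i} → i ∈ L → insideEdge i ≡ true
  ∈L⇒inside = ∈-members⁻ insideEdge

  ∈H⇒inside : ∀ {i} → i ∈ H → insideEdge i ≡ true
  ∈H⇒inside i∈H = ∈L⇒inside (Anyₚ.reverse⁻ i∈H)

  -- Inside edges only meet the `q + 1` vertices of `S`, so they cause at most `q` merges.
  vertexBound : ∀ {q} → count S ≡ suc q → v ≤ size (V.quotient H) + q
  vertexBound {q} S≡ = V.size-ʳ++ L [] label λ i∈L →
    labelled (rep _) (∧-trueˡ (∈L⇒inside i∈L)) ,
    labelled (rev (rep _)) (∧-trueʳ {S (src (rep _))} (∈L⇒inside i∈L))
    where
    SL : length (members S) ≡ suc q
    SL = trans (length-members S) S≡
    at : Fin (suc q) → Fin (length (members S))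
    at = Fin.cast (sym SL)
    at-dart : ∀ l → Σ D λ d → src d ≡ List.lookup (members S) (at l)
    at-dart l = dartAt _ (∈-members⁻ S (∈ₚ.∈-lookup (at l)))
    label : Fin (suc q) → Fin v
    label l = vertex (proj₁ (at-dart l))
    labelled : ∀ d → S (src d) ≡ true → ∃[ l ] vertex d ≡ label l
    labelled d Sd = Fin.cast SL (Any.index d∈) , vertex-src (trans (Anyₚ.lookup-index d∈)
      (trans (cong (List.lookup (members S)) (sym (Finₚ.cast-involutive (sym SL) SL (Any.index d∈))))
             (sym (proj₂ (at-dart _)))))
      where
      d∈ : src d ∈ members S
      d∈ = ∈-members⁺ S Sd

  -- The ends of inside edges in the dual lie in the listed regions. Allowing one merge per region,
  -- rather than one fewer, also covers the empty list.
  faceBound : size (F.quotient K′) ≤ size (F.quotient (H ʳ++ K′)) + length regions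
  faceBound = go H regions λ {i} i∈H →
    ∈-members⁺ touched (dec-true (Finₚ.any? (touches? _)) (i , ∈H⇒inside i∈H , inj₁ refl)) ,
    ∈-members⁺ touched (dec-true (Finₚ.any? (touches? _)) (i , ∈H⇒inside i∈H , inj₂ refl))
    where
    go : ∀ H (rs : List (Fin (size (F.quotient K′)))) →
         (∀ {i} → i ∈ H → region (rep i) ∈ rs × region (rev (rep i)) ∈ rs) →
         size (F.quotient K′) ≤ size (F.quotient (H ʳ++ K′)) + length rs
    go []      rs       _  = ℕₚ.m≤m+n _ _
    go (i ∷ H) []       ∈rs = contradiction (proj₁ (∈rs (here refl))) λ ()
    go (i ∷ H) (r ∷ rs) ∈rs = ℕₚ.≤-trans (F.size-ʳ++ (i ∷ H) K′ (List.lookup (r ∷ rs))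
      λ j∈ → (Any.index (proj₁ (∈rs j∈)) , Anyₚ.lookup-index (proj₁ (∈rs j∈))) ,
             (Any.index (proj₂ (∈rs j∈)) , Anyₚ.lookup-index (proj₂ (∈rs j∈))))
      (ℕₚ.+-monoʳ-≤ (size (F.quotient ((i ∷ H) ʳ++ K′))) (ℕₚ.n≤1+n (length rs)))

  edgeBound : ∀ {q} → count S ≡ suc q → length H ≤ length regions + q
  edgeBound S≡ = O.edges-bound {c = c} K H K∪H (trans (sym (ℕₚ.+-identityʳ (v + f))) euler) e≡K+H
    vertexClasses≤ faceClasses≤ (vertexBound S≡) faceBound

  -- With `h` edges and `p` regions, eliminating `p` bounds the average degree strictly below
  -- `2 g / (g - 2)` for `g > 2`: below 3 for `g = 6` and below 10/3 for `g = 5`.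
  sparse : 0 < count S → ∃[ h ] ∃[ p ] volume G S ≤ h + h × suc h ≤ p + count S × p * g ≤ h + h
  sparse 0<S = length H , length regions , volume≤ , strict (count S) refl 0<S , regions*girth≤
    where
    strict : ∀ s → count S ≡ s → 0 < s → suc (length H) ≤ length regions + s
    strict (suc q) S≡ _ = subst (suc (length H) ≤_) (sym (ℕₚ.+-suc (length regions) q)) (s≤s (edgeBound S≡))

-- From colourings to inversions

module _ {n : ℕ} {G : Graph n} where

  open Graph G using (adj; symmetric; loopless)

  ≈-sym : {O O′ : Orientation G} → O ≈ O′ → O′ ≈ O
  ≈-sym eq u v = sym (eq u v)

  ≈-trans : {O O′ O″ : Orientation G} → O ≈ O′ → O′ ≈ O″ → O ≈ O″
  ≈-trans p q u v = trans (p u v) (q u v)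

  invert-cong : ∀ X {O O′ : Orientation G} → O ≈ O′ → invert X O ≈ invert X O′
  invert-cong X eq u v with Vec.lookup X u ∧ Vec.lookup X v
  ... | true  = eq v u
  ... | false = eq u v

  invertAll-cong : ∀ {k} (Xs : Vec (Subset n) k) {O O′ : Orientation G} → O ≈ O′ → invertAll Xs O ≈ invertAll Xs O′
  invertAll-cong []       eq = eq
  invertAll-cong (X ∷ Xs) {O} {O′} eq = invertAll-cong Xs {invert X O} {invert X O′} (invert-cong X {O} {O′} eq)

  TransformableIn-resp : ∀ {k} {O P O′ P′ : Orientation G} → O ≈ P → O′ ≈ P′ →
                         TransformableIn k O O′ → TransformableIn k P P′
  TransformableIn-resp {O = O} {P} {O′} {P′} p q (Xs , eq) = Xs ,
    ≈-trans {invertAll Xs P} {invertAll Xs O} {P′} (invertAll-cong Xs {P} {O} (≈-sym {O} {P} p))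
      (≈-trans {invertAll Xs O} {O′} {P′} eq q)

  IsInversionDistance-resp : ∀ {d} {O P O′ P′ : Orientation G} → O ≈ P → O′ ≈ P′ →
                             IsInversionDistance O O′ d → IsInversionDistance P P′ d
  IsInversionDistance-resp {O = O} {P} {O′} {P′} p q (t , min) =
    TransformableIn-resp {O = O} {P} {O′} {P′} p q t ,
    λ k t′ → min k (TransformableIn-resp {O = P} {O} {P′} {O′} (≈-sym {O} {P} p) (≈-sym {O′} {P′} q) t′)

  -- Decidability of distances and existence of the diameter

  _≈?_ : (O O′ : Orientation G) → Dec (O ≈ O′)
  O ≈? O′ = Finₚ.all? λ u → Finₚ.all? λ v → arc O u v Boolₚ.≟ arc O′ u v

  transformable? : ∀ k (O O′ : Orientation G) → Dec (TransformableIn k O O′)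
  transformable? zero    O O′ = map′ ([] ,_) (λ { ([] , eq) → eq }) (O ≈? O′)
  transformable? (suc k) O O′ = map′
    (λ (X , Xs , eq) → (X ∷ Xs) , eq) (λ { ((X ∷ Xs) , eq) → X , Xs , eq })
    (anySubset? λ X → transformable? k (invert X O) O′)

  distance? : ∀ (O O′ : Orientation G) d → Dec (IsInversionDistance O O′ d)
  distance? O O′ d = transformable? d O O′ ×-dec
    map′ (λ none k t → ℕₚ.≮⇒≥ (λ k<d → none k<d t)) (λ min {k} k<d t → ℕₚ.<⇒≱ k<d (min k t))
         (ℕₚ.allUpTo? (λ k → ¬? (transformable? k O O′)) d)

  -- Orientations are enumerated up to ≈ through their n × n arc matrices.
  entry : Subset (n * n) → Fin n → Fin n → Bool
  entry X u v = Vec.lookup X (combine u v)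

  Orients : (Fin n → Fin n → Bool) → Set
  Orients a = (∀ u v → T (a u v) → Adj G u v) × (∀ u v → Adj G u v → a v u ≡ not (a u v))

  orients? : ∀ a → Dec (Orients a)
  orients? a =
    (Finₚ.all? λ u → Finₚ.all? λ v → T? (a u v) →-dec T? (adj u v)) ×-dec
    (Finₚ.all? λ u → Finₚ.all? λ v → T? (adj u v) →-dec (a v u Boolₚ.≟ not (a u v)))

  fromMatrix : ∀ a → Orients a → Orientation G
  fromMatrix a (p , q) = record { arc = a ; arc⇒adj = p ; oriented = q }

  toMatrix : Orientation G → Subset (n * n)
  toMatrix O = Vec.tabulate (λ x → uncurry (arc O) (Fin.remQuot n x))

  entry-toMatrix : ∀ O u v → entry (toMatrix O) u v ≡ arc O u v
  entry-toMatrix O u v = trans (Vecₚ.lookup∘tabulate _ (combine u v))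
    (cong (uncurry (arc O)) (Finₚ.remQuot-combine u v))

  toMatrix-orients : ∀ O → Orients (entry (toMatrix O))
  toMatrix-orients O =
    (λ u v a → Orientation.arc⇒adj O u v (subst T (entry-toMatrix O u v) a)) ,
    λ u v uv → trans (entry-toMatrix O v u)
      (trans (Orientation.oriented O u v uv) (cong not (sym (entry-toMatrix O u v))))

  -- The search runs over matrices, which represent an orientation only up to `≈`; hence `P` has to
  -- respect `≈`.
  anyOrientation? : ∀ {P : Orientation G → Set} → (∀ {O O′} → O ≈ O′ → P O → P O′) → (∀ O → Dec (P O)) →
                    Dec (∃ P)
  anyOrientation? {P} resp P? = map′
    (λ (X , o , p) → fromMatrix (entry X) o , p)
    (λ (O , p) → toMatrix O , toMatrix-orients O ,
       resp {O} (λ u v → sym (entry-toMatrix O u v)) p)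
    (anySubset? search)
    where
    search : ∀ X → Dec (∃ λ o → P (fromMatrix (entry X) o))
    search X with orients? (entry X)
    ... | no ¬o = no (¬o ∘ proj₁)
    ... | yes o = map′ (o ,_) (λ (o′ , p) → resp {fromMatrix (entry X) o′} (λ _ _ → refl) p) (P? (fromMatrix (entry X) o))

  attained? : ∀ d → Dec (∃[ O ] ∃[ O′ ] IsInversionDistance {G = G} O O′ d)
  attained? d = anyOrientation?
    (λ {O} {P} eq (O′ , dist) → O′ , IsInversionDistance-resp {O = O} {P} {O′} {O′} eq (λ _ _ → refl) dist)
    λ O → anyOrientation?
      (λ {O′} {P′} eq dist → IsInversionDistance-resp {O = O} {O} {O′} {P′} (λ _ _ → refl) eq dist)
      (λ O′ → distance? O O′ d)

  someOrientation : Orientation G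
  someOrientation = fromMatrix (λ u v → adj u v ∧ does (u Fin.<? v)) (arcs , orient)
    where
    arcs : ∀ u v → T (adj u v ∧ does (u Fin.<? v)) → Adj G u v
    arcs u v p = true⇒T (∧-trueˡ (T⇒true p))
    flips : ∀ u v → u ≢ v → does (v Fin.<? u) ≡ not (does (u Fin.<? v))
    flips u v u≢v with Finₚ.<-cmp u v
    ... | tri< u<v _ v≮u = trans (dec-false (v Fin.<? u) v≮u) (cong not (sym (dec-true (u Fin.<? v) u<v)))
    ... | tri≈ _ u≡v _   = contradiction u≡v u≢v
    ... | tri> u≮v _ v<u = trans (dec-true (v Fin.<? u) v<u) (cong not (sym (dec-false (u Fin.<? v) u≮v)))
    orient : ∀ u v → Adj G u v → adj v u ∧ does (v Fin.<? u) ≡ not (adj u v ∧ does (u Fin.<? v))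
    orient u v uv rewrite symmetric v u | T⇒true uv =
      flips u v λ { refl → true≢false (T⇒true uv) (loopless u) }

  -- The upper bound is lowered from `t` until it is an attained distance; 0 is attained by an
  -- orientation and itself.
  bounded⇒diameter : ∀ t → (∀ O O′ → TransformableIn {G = G} t O O′) →
                     ∃[ D ] (IsInversionDiameter G D × D ≤ t)
  bounded⇒diameter t all = greatest t ℕₚ.≤-refl (λ O O′ d (_ , min) → min t (all O O′))
    where
    greatest : ∀ m → m ≤ t → (∀ O O′ d → IsInversionDistance {G = G} O O′ d → d ≤ m) →
               ∃[ D ] (IsInversionDiameter G D × D ≤ t)
    greatest zero    m≤t bound = zero ,
      ((someOrientation , someOrientation , ([] , λ _ _ → refl) , λ _ _ → z≤n) , bound) , m≤t
    greatest (suc m) m≤t bound with attained? (suc m)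
    ... | yes found = suc m , (found , bound) , m≤t
    ... | no ¬found = greatest m (ℕₚ.<⇒≤ m≤t) λ O O′ d dist →
      ℕₚ.≤-pred (ℕₚ.≤∧≢⇒< (bound O O′ d dist) λ { refl → ¬found (O , O′ , dist) })

  -- Vertex u lies in the i-th inverted set iff the i-th coordinate of x u is 1, so the pair uv is
  -- reversed x u · x v times.
  inversions : ∀ {t} → (Fin n → 𝔽₂^ t) → Vec (Subset n) t
  inversions {zero}  x = []
  inversions {suc t} x = Vec.tabulate (Vec.head ∘ x) ∷ inversions (Vec.tail ∘ x)

  arc-inversions : ∀ {t} (x : Fin n → 𝔽₂^ t) (O : Orientation G) {u v} → adj u v ≡ true →
                   arc (invertAll (inversions x) O) u v ≡ arc O u v xor (x u · x v)
  arc-inversions {zero}  x O {u} {v} uv with x u | x v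
  ... | [] | [] = sym (Boolₚ.xor-identityʳ _)
  arc-inversions {suc t} x O {u} {v} uv = begin
    arc (invertAll (inversions (Vec.tail ∘ x)) (invert X O)) u v
      ≡⟨ arc-inversions (Vec.tail ∘ x) (invert X O) uv ⟩
    arc (invert X O) u v xor (Vec.tail (x u) · Vec.tail (x v))
      ≡⟨ cong (_xor (Vec.tail (x u) · Vec.tail (x v))) once ⟩
    (arc O u v xor (Vec.head (x u) ∧ Vec.head (x v))) xor (Vec.tail (x u) · Vec.tail (x v))
      ≡⟨ Boolₚ.xor-assoc (arc O u v) _ _ ⟩
    arc O u v xor ((Vec.head (x u) ∧ Vec.head (x v)) xor (Vec.tail (x u) · Vec.tail (x v)))
      ≡⟨ cong (arc O u v xor_) (split (x u) (x v)) ⟩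
    arc O u v xor (x u · x v)
      ∎
    where
    open ≡-Reasoning
    X = Vec.tabulate (Vec.head ∘ x)
    split : ∀ {t} (a b : 𝔽₂^ (suc t)) → (Vec.head a ∧ Vec.head b) xor (Vec.tail a · Vec.tail b) ≡ a · b
    split (a ∷ as) (b ∷ bs) = refl
    once : arc (invert X O) u v ≡ arc O u v xor (Vec.head (x u) ∧ Vec.head (x v))
    once rewrite Vecₚ.lookup∘tabulate (Vec.head ∘ x) u | Vecₚ.lookup∘tabulate (Vec.head ∘ x) v
      with Vec.head (x u) ∧ Vec.head (x v)
    -- On an edge, reversing the arc complements its indicator.
    ... | true  = trans (Orientation.oriented O u v (true⇒T uv)) (sym (trans (Boolₚ.xor-comm (arc O u v) true) refl))
    ... | false = sym (Boolₚ.xor-identityʳ _)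

  arc-nonadjacent : ∀ (O : Orientation G) {u v} → adj u v ≡ false → arc O u v ≡ false
  arc-nonadjacent O {u} {v} ¬uv = Boolₚ.¬-not λ a →
    true≢false (T⇒true (Orientation.arc⇒adj O u v (true⇒T a))) ¬uv

  disagreement : (O O′ : Orientation G) → Fin n → Fin n → Bool
  disagreement O O′ u v = arc O u v xor arc O′ u v

  disagreement-sym : ∀ O O′ {u v} → adj u v ≡ true → disagreement O O′ u v ≡ disagreement O O′ v u
  disagreement-sym O O′ {u} {v} uv = sym (trans
    (cong₂ _xor_ (Orientation.oriented O u v (true⇒T uv)) (Orientation.oriented O′ u v (true⇒T uv)))
    (not-xor-not (arc O u v) (arc O′ u v)))
    where
    not-xor-not : ∀ a b → not a xor not b ≡ a xor b
    not-xor-not true  b = refl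
    not-xor-not false b = Boolₚ.not-involutive b

  -- The labelling to realise marks the edges on which `O` and `O′` differ; reversing exactly these
  -- turns `O` into `O′`.
  colourings⇒transformable : ∀ {t} →
    (∀ π (π-sym : ∀ {u v} → adj u v ≡ true → π u v ≡ π v u) → Colouring G t π π-sym (λ _ → true)) →
    ∀ O O′ → TransformableIn {G = G} t O O′
  colourings⇒transformable col O O′ = inversions x , agree
    where
    C = col (disagreement O O′) (disagreement-sym O O′)
    x = Colouring.colour C
    agree : invertAll (inversions x) O ≈ O′
    agree u v with dichotomy (adj u v)
    ... | inj₂ ¬uv = trans (arc-nonadjacent (invertAll (inversions x) O) ¬uv) (sym (arc-nonadjacent O′ ¬uv))
    ... | inj₁ uv = trans (arc-inversions x O uv)
      (trans (cong (arc O u v xor_) (Colouring.respects C refl refl uv))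
        (trans (sym (Boolₚ.xor-assoc (arc O u v) (arc O u v) (arc O′ u v)))
          (cong (_xor arc O′ u v) (Boolₚ.xor-same (arc O u v)))))

-- The bounds for girth 5 and 6

girth⇒triangleFree : ∀ {n} {G : Graph n} {g} → 3 < g → (∀ k → Cycle G k → g ≤ k) → TriangleFree G
girth⇒triangleFree {n} {G} 3<g girth {u} {v} {w} uv vw uw = ℕₚ.<⇒≱ 3<g (girth 3 record
  { 3≤length = ℕₚ.≤-refl
  ; vertex   = corner
  ; distinct = distinct
  ; steps    = steps
  ; closing  = closing
  })
  where
  open Graph G using (adj; loopless)
  corner : Fin 3 → Fin n
  corner zero             = u
  corner (suc zero)       = v
  corner (suc (suc zero)) = w
  irreflexive : ∀ {a b} → adj a b ≡ true → a ≢ b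
  irreflexive {a} e refl = true≢false e (loopless a)
  distinct : ∀ {i j} → corner i ≡ corner j → i ≡ j
  distinct {zero}         {zero}         _ = refl
  distinct {zero}         {suc zero}     e = contradiction e (irreflexive uv)
  distinct {zero}         {suc (suc zero)} e = contradiction e (irreflexive uw)
  distinct {suc zero}     {zero}         e = contradiction (sym e) (irreflexive uv)
  distinct {suc zero}     {suc zero}     _ = refl
  distinct {suc zero}     {suc (suc zero)} e = contradiction e (irreflexive vw)
  distinct {suc (suc zero)} {zero}       e = contradiction (sym e) (irreflexive uw)
  distinct {suc (suc zero)} {suc zero}   e = contradiction (sym e) (irreflexive vw)
  distinct {suc (suc zero)} {suc (suc zero)} _ = refl
  steps : ∀ i j → toℕ j ≡ suc (toℕ i) → Adj G (corner i) (corner j)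
  steps zero       (suc zero)       _ = true⇒T uv
  steps (suc zero) (suc (suc zero)) _ = true⇒T vw
  steps (suc (suc zero)) zero ()
  steps (suc (suc zero)) (suc zero) ()
  steps (suc (suc zero)) (suc (suc zero)) ()
  closing : ∀ i j → suc (toℕ i) ≡ 3 → toℕ j ≡ 0 → Adj G (corner i) (corner j)
  closing (suc (suc zero)) zero _ _ = true⇒T (adj-sym G uw)

reducible⇒diameter≤ : ∀ {n} {G : Graph n} t {g} → 3 < g → (∀ k → Cycle G k → g ≤ k) → 2 < t →
  (∀ {π} {π-sym : ∀ {u v} → Graph.adj G u v ≡ true → π u v ≡ π v u} S → 0 < count S →
     ¬ Irreducible G t π π-sym S) →
  ∃[ D ] (IsInversionDiameter G D × D ≤ t)
reducible⇒diameter≤ {G = G} t 3<g girth 2<t reducible = bounded⇒diameter t (colourings⇒transformable λ π π-sym →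
  colouring G t π π-sym (girth⇒triangleFree 3<g girth) 2<t (reducible {π} {π-sym}))

girth5-contradiction : ∀ {h p s V} → V ≤ h + h → suc h ≤ p + s → p * 5 ≤ h + h → ¬ (20 * s ≤ 6 * V)
girth5-contradiction {h} {p} {s} {V} V≤ h< p≤ s≤ = ℕₚ.<-irrefl refl (begin-strict
  20 * h            <⟨ ℕₚ.*-monoʳ-< 20 h< ⟩
  -- The factor 20 lets both `5 p ≤ 2 h` and `20 s ≤ 12 h` be used, giving `8 h + 12 h`.
  20 * (p + s)      ≡⟨ solve 2 (λ p s → con 20 :* (p :+ s) := con 4 :* (p :* con 5) :+ con 20 :* s) refl p s ⟩
  4 * (p * 5) + 20 * s  ≤⟨ ℕₚ.+-mono-≤ (ℕₚ.*-monoʳ-≤ 4 p≤) (ℕₚ.≤-trans s≤ (ℕₚ.*-monoʳ-≤ 6 V≤)) ⟩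
  4 * (h + h) + 6 * (h + h) ≡⟨ solve 1 (λ h → con 4 :* (h :+ h) :+ con 6 :* (h :+ h) := con 20 :* h) refl h ⟩
  20 * h            ∎)
  where
  open ℕₚ.≤-Reasoning
  open +-*-Solver

girth6-contradiction : ∀ {h p s V} → V ≤ h + h → suc h ≤ p + s → p * 6 ≤ h + h → ¬ (6 * s ≤ 2 * V)
girth6-contradiction {h} {p} {s} {V} V≤ h< p≤ s≤ = ℕₚ.<-irrefl refl (begin-strict
  6 * h             <⟨ ℕₚ.*-monoʳ-< 6 h< ⟩
  -- The two terms are at most `2 h` and `4 h`.
  6 * (p + s)       ≡⟨ solve 2 (λ p s → con 6 :* (p :+ s) := p :* con 6 :+ con 6 :* s) refl p s ⟩
  p * 6 + 6 * s     ≤⟨ ℕₚ.+-mono-≤ p≤ (ℕₚ.≤-trans s≤ (ℕₚ.*-monoʳ-≤ 2 V≤)) ⟩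
  h + h + 2 * (h + h) ≡⟨ solve 1 (λ h → h :+ h :+ con 2 :* (h :+ h) := con 6 :* h) refl h ⟩
  6 * h             ∎)
  where
  open ℕₚ.≤-Reasoning
  open +-*-Solver

theorem4p9 : (∀ {n} (G : Graph n) → Planar G → HasGirth G 5 →
    ∃[ D ] (IsInversionDiameter G D × D ≤ 7)) ×
    (∀ {n} (G : Graph n) → Planar G → HasGirth G 6 →
    ∃[ D ] (IsInversionDiameter G D × D ≤ 5))
theorem4p9 = girth5 , girth6
  where
  girth5 : ∀ {n} (G : Graph n) → Planar G → HasGirth G 5 → ∃[ D ] (IsInversionDiameter G D × D ≤ 7)
  girth5 G (R , genus) (_ , girth) =
    reducible⇒diameter≤ 7 (s≤s (s≤s (s≤s (s≤s z≤n)))) girth (s≤s (s≤s (s≤s z≤n))) reducible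
    where
    reducible : ∀ {π} {π-sym : ∀ {u v} → Graph.adj G u v ≡ true → π u v ≡ π v u} S → 0 < count S →
                ¬ Irreducible G 7 π π-sym S
    reducible S 0<S irr =
      let h , p , vol≤ , h< , p≤ = sparse R genus girth S (Irreducible.2≤deg irr) 0<S
      in girth5-contradiction {h} {p} {count S} {volume G S} vol≤ h< p≤ (irreducible⇒volume₇ G S irr)
  girth6 : ∀ {n} (G : Graph n) → Planar G → HasGirth G 6 → ∃[ D ] (IsInversionDiameter G D × D ≤ 5)
  girth6 G (R , genus) (_ , girth) =
    reducible⇒diameter≤ 5 (s≤s (s≤s (s≤s (s≤s z≤n)))) girth (s≤s (s≤s (s≤s z≤n))) reducible
    where
    reducible : ∀ {π} {π-sym : ∀ {u v} → Graph.adj G u v ≡ true → π u v ≡ π v u} S → 0 < count S →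
                ¬ Irreducible G 5 π π-sym S
    reducible S 0<S irr =
      let h , p , vol≤ , h< , p≤ = sparse R genus girth S (Irreducible.2≤deg irr) 0<S
      in girth6-contradiction {h} {p} {count S} {volume G S} vol≤ h< p≤ (irreducible⇒volume₅ G S irr)
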